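{- There exists an optimal $(v,4,1)$-optical orthogonal code for every positive integer $v\equiv 1,4\pmod{12}$ with $v\notin\{16,25,28\}$.
   Context: A $(v,k,1)$-optical orthogonal code (OOC) $\mathcal{C}$ is a family of $(0,1)$-sequences (codewords) of length $v$ and weight $k$ such that for any $\mathbf{x}=(x_0,\dots,x_{v-1})\in\mathcal{C}$, $\mathbf{y}=(y_0,\dots,y_{v-1})\in\mathcal{C}$ and any integer $r$, $\sum_{i=0}^{v-1}x_iy_{i+r}\le 1$ whenever $\mathbf{x}\ne\mathbf{y}$ or $r\ne 0$ (indices taken modulo $v$). A $(v,k,1)$-OOC is optimal if it has $\lfloor (v-1)/(k(k-1))\rfloor$ codewords. -}

module Defs where

open import Data.Fin using (Fin; toℕ; fromℕ<)
open import Data.Integer using (ℤ; +_; _%ℕ_) renaming (_+_ to _+ℤ_)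
open import Data.Integer.DivMod using (n%ℕd<d)
open import Data.Integer.Divisibility using () renaming (_∣_ to _∣ℤ_)
open import Data.List using (List; length)
open import Data.List.Membership.Propositional using (_∈_)
open import Data.List.Relation.Unary.Unique.Propositional using (Unique)
open import Data.Nat using (ℕ; NonZero; _*_; _∸_; _≤_; _/_)
open import Data.Sum using (_⊎_)
open import Data.Vec using (Vec; lookup; map; sum; tabulate)
open import Relation.Binary.PropositionalEquality using (_≡_; _≢_)
open import Relation.Nullary using (¬_)

BinarySequence : ℕ → Set
BinarySequence v = Vec (Fin 2) v

weight : ∀ {v} → BinarySequence v → ℕ
weight x = sum (map toℕ x)

-- The index i + r, taken modulo v.
shift : ∀ {v} .{{_ : NonZero v}} → ℤ → Fin v → Fin v
shift {v} r i = fromℕ< (n%ℕd<d (+ toℕ i +ℤ r) v)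

correlation : ∀ {v} .{{_ : NonZero v}} →
              BinarySequence v → BinarySequence v → ℤ → ℕ
correlation x y r =
  sum (tabulate λ i → toℕ (lookup x i) * toℕ (lookup y (shift r i)))

-- Codewords are listed without repetition, so that the length of the list is
-- the number of codewords.  Since indices are taken modulo v, the condition
-- r ≠ 0 on the shift means that r is not a multiple of v.
record IsOOC (v k : ℕ) .{{_ : NonZero v}} (C : List (BinarySequence v)) : Set where
  field
    distinct            : Unique C
    constant-weight     : ∀ {x} → x ∈ C → weight x ≡ k
    bounded-correlation : ∀ {x y} → x ∈ C → y ∈ C → (r : ℤ) →
                          x ≢ y ⊎ ¬ (+ v ∣ℤ r) → correlation x y r ≤ 1

record IsOptimalOOC (v k : ℕ) .{{_ : NonZero v}} .{{_ : NonZero (k * (k ∸ 1))}}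
                    (C : List (BinarySequence v)) : Set where
  field
    isOOC : IsOOC v k C
    size  : length C ≡ (v ∸ 1) / (k * (k ∸ 1))

{-# OPTIONS --safe #-}
module Submission where

-- A block B with marks in [0, v) contributes the distances min(d, v − d) of its
-- pairs, d being the difference of the two marks.  If all distances of all blocks
-- are distinct and below v / 2, the indicator sequences of the blocks form an OOC,
-- so 12 t + 1 and 12 t + 4 call for t four-element blocks with 6 t distinct
-- distances.  For t ≥ 21 write t = 6 n + r with −3 ≤ r ≤ 2.  Six families
-- {0, A n + a + i, B n + b + 2 i, C n + c + 3 i}, with i running over about n
-- values, have as distances arithmetic progressions of steps 1, 2 and 3 which,
-- interleaved two by two and three by three, nearly tile [1, v / 2].  The gaps lie
-- within bounded distance of the multiples of n and are filled by a bounded number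
-- of further blocks whose marks are linear in n.  These blocks, and those for
-- t < 21, come from a computer search; that two progressions with coefficients
-- linear in n = m + 4 are disjoint for every m follows from comparing coefficients
-- or residues modulo 2 or 3, which is decidable.

open import Defs
open import Algebra.Properties.AbelianGroup using (∙-cancelˡ)
open import Algebra.Properties.CommutativeSemigroup using (interchange)
open import Data.Bool using (true; false; if_then_else_)
open import Data.Fin using (Fin; toℕ; fromℕ<) renaming (zero to fzero; suc to fsuc)
open import Data.Fin.Properties using (toℕ<n; toℕ-fromℕ<; toℕ-injective) renaming (suc-injective to fsuc-injective)
open import Data.Integer as ℤ using (ℤ; +_; ∣_∣; _/ℕ_; _⊖_)
import Data.Integer.Properties as ℤ
open import Data.Integer.DivMod using (a≡a%ℕn+[a/ℕn]*n)
open import Data.Integer.Divisibility using () renaming (_∣_ to _∣ℤ_)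
open import Data.Integer.Tactic.RingSolver using () renaming (solve-∀ to ℤ-solve-∀)
open import Data.List as List using (List; []; _∷_; _++_; length; concat; applyUpTo)
open import Data.List.Membership.Propositional using (_∈_; _∉_)
open import Data.List.Membership.Propositional.Properties using (∈-map⁺; ∈-map⁻; ∈-++⁺ˡ; ∈-++⁺ʳ)
import Data.List.Properties as List
open import Data.List.Relation.Unary.All as All using (All; []; _∷_)
import Data.List.Relation.Unary.All.Properties as All
open import Data.List.Relation.Unary.AllPairs as AllPairs using (AllPairs; []; _∷_)
import Data.List.Relation.Unary.AllPairs.Properties as AllPairs
open import Data.List.Relation.Unary.Any using (here; there)
open import Data.Nat
open import Data.Nat.Divisibility using (divides; n∣m*n)
open import Data.Nat.DivMod
open import Data.Nat.ListAction using (sum)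
open import Data.Nat.Properties
open import Data.Nat.Tactic.RingSolver using (solve-∀)
open import Data.Product using (_×_; _,_; proj₁; proj₂; ∃-syntax)
open import Data.Sum using (_⊎_; inj₁; inj₂; [_,_]′)
open import Data.Vec as Vec using (lookup; tabulate)
import Data.Vec.Properties as Vec
open import Function using (_∘_)
open import Relation.Binary using (Rel; tri<; tri≈; tri>)
open import Relation.Binary.PropositionalEquality
open import Relation.Nullary using (¬_; Dec; yes; no; contradiction; does)
open import Relation.Nullary.Decidable using (_×-dec_; _⊎-dec_; ¬?; map′; toWitness)

-- Pairs of members of a list

private
  variable
    A : Set

-- `AllPairs` relates earlier members to later ones only, so two arbitrary members are related in
-- one of the two orders unless they coincide.
lookup-pair : ∀ {R : A → A → Set} {xs x y} →
              AllPairs R xs → x ∈ xs → y ∈ xs → x ≡ y ⊎ R x y ⊎ R y x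
lookup-pair (_ ∷ _)  (here refl) (here refl) = inj₁ refl
lookup-pair (r ∷ _)  (here refl) (there y∈)  = inj₂ (inj₁ (All.lookup r y∈))
lookup-pair (r ∷ _)  (there x∈)  (here refl) = inj₂ (inj₂ (All.lookup r x∈))
lookup-pair (_ ∷ rs) (there x∈)  (there y∈)  = lookup-pair rs x∈ y∈

map-with-All : ∀ {P : A → Set} {R S : A → A → Set} {xs} →
               (∀ {x y} → P x → P y → R x y → S x y) →
               All P xs → AllPairs R xs → AllPairs S xs
map-with-All f []       []       = []
map-with-All f (p ∷ ps) (r ∷ rs) =
  All.zipWith (λ (q , s) → f p q s) (ps , r) ∷ map-with-All f ps rs

-- Recovers the full square from its diagonal and the two orders off the diagonal. It serves to
-- compare the distances of two blocks that come from the same list of forms.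
AllPairs⇒All² : ∀ {P : A → A → Set} {xs} → All (λ x → P x x) xs →
                AllPairs (λ x y → P x y × P y x) xs → All (λ x → All (P x) xs) xs
AllPairs⇒All² []       []       = []
AllPairs⇒All² (p ∷ ps) (r ∷ rs) = (p ∷ All.map proj₁ r) ∷
  All.zipWith (λ (q , s) → proj₂ q ∷ s) (r , AllPairs⇒All² ps rs)

pairs : List A → List (A × A)
pairs []       = []
pairs (x ∷ xs) = List.map (x ,_) xs ++ pairs xs

-- In an increasing list the smaller member comes first, which is the order in which `pairs` forms
-- its pairs.
∈-pairs : ∀ {B a b} → AllPairs _<_ B → a ∈ B → b ∈ B → a < b → (a , b) ∈ pairs B
∈-pairs (_ ∷ _)  (here refl) (here refl) a<a = contradiction refl (<⇒≢ a<a)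
∈-pairs (_ ∷ _)  (here refl) (there b∈)  _   = ∈-++⁺ˡ (∈-map⁺ _ b∈)
∈-pairs (b< ∷ _) (there a∈)  (here refl) a<b = contradiction a<b (<-asym (All.lookup b< a∈))
∈-pairs (_ ∷ B<) (there a∈)  (there b∈)  a<b = ∈-++⁺ʳ _ (∈-pairs B< a∈ b∈ a<b)

-- Cyclic distances and packings

fold : ℕ → ℕ → ℕ
fold v d = d ⊓ (v ∸ d)

fold-∸ : ∀ {v d} → d ≤ v → fold v (v ∸ d) ≡ fold v d
fold-∸ {v} {d} d≤v = trans (cong ((v ∸ d) ⊓_) (m∸[m∸n]≡n d≤v)) (⊓-comm (v ∸ d) d)

dist : ℕ → ℕ × ℕ → ℕ
dist v (a , b) = fold v (b ∸ a)

-- `halved` rules out the distance v / 2: the shift by v / 2 would swap the two marks of such a pair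
-- and produce an autocorrelation of at least 2.
record IsBlock (v : ℕ) (B : List ℕ) : Set where
  field
    increasing : AllPairs _<_ B
    bounded    : All (_< v) B
    halved     : All (λ p → 2 * dist v p < v) (pairs B)
    spread     : AllPairs (λ p q → dist v p ≢ dist v q) (pairs B)

Separated : ℕ → Rel (List ℕ) _
Separated v B B′ = All (λ p → All (λ q → dist v p ≢ dist v q) (pairs B′)) (pairs B)

record IsPacking (v k : ℕ) (𝓑 : List (List ℕ)) : Set where
  field
    blocks    : All (IsBlock v) 𝓑
    sizes     : All (λ B → length B ≡ k) 𝓑
    separated : AllPairs (Separated v) 𝓑

-- Indicator sequences and their weights

bit : ℕ → List ℕ → Fin 2
bit i []      = fzero
bit i (b ∷ B) = if i ≡ᵇ b then fsuc fzero else bit i B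

codeword : ∀ v → List ℕ → BinarySequence v
codeword v B = tabulate λ i → bit (toℕ i) B

bit⁻ : ∀ i B → toℕ (bit i B) ≢ 0 → i ∈ B
bit⁻ i []      ≢0 = contradiction refl ≢0
bit⁻ i (b ∷ B) ≢0 with i ≡ᵇ b | ≡ᵇ⇒≡ i b
... | true  | eq = here (eq _)
... | false | _  = there (bit⁻ i B ≢0)

bit⁺ : ∀ i B → i ∈ B → bit i B ≡ fsuc fzero
bit⁺ i (b ∷ B) i∈ with i ≡ᵇ b | ≡⇒≡ᵇ i b
bit⁺ i (b ∷ B) i∈         | true  | _ = refl
bit⁺ i (b ∷ B) (here eq)  | false | f = contradiction eq f
bit⁺ i (b ∷ B) (there i∈) | false | _ = bit⁺ i B i∈

-- As b is new, a position is never counted twice; the weight of a codeword is thus a sum of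
-- indicators, one for each mark.
bit-∷ : ∀ i b B → b ∉ B → toℕ (bit i (b ∷ B)) ≡ (if i ≡ᵇ b then 1 else 0) + toℕ (bit i B)
bit-∷ i b B b∉ with i ≡ᵇ b | ≡ᵇ⇒≡ i b
... | false | _  = refl
... | true  | eq with eq _
... | refl with bit i B in e
...   | fzero      = refl
...   | fsuc fzero = contradiction (bit⁻ b B λ e₀ → contradiction (trans (sym (cong toℕ e)) e₀) λ ()) b∉

bit≤1 : (x : Fin 2) → toℕ x ≤ 1
bit≤1 x = s≤s⁻¹ (toℕ<n x)

sum-zero : ∀ n (f : Fin n → ℕ) → (∀ i → f i ≡ 0) → Vec.sum (tabulate f) ≡ 0
sum-zero zero    f f≡0 = refl
sum-zero (suc n) f f≡0 = cong₂ _+_ (f≡0 fzero) (sum-zero n (f ∘ fsuc) (f≡0 ∘ fsuc))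

sum-+ : ∀ n (f g : Fin n → ℕ) → Vec.sum (tabulate λ i → f i + g i) ≡
        Vec.sum (tabulate f) + Vec.sum (tabulate g)
sum-+ zero    f g = refl
sum-+ (suc n) f g = trans (cong (λ n → f fzero + g fzero + n) (sum-+ n (f ∘ fsuc) (g ∘ fsuc)))
  (interchange +-commutativeSemigroup (f fzero) (g fzero) _ _)

sum-indicator : ∀ n b → b < n → Vec.sum (tabulate {n = n} λ i → if toℕ i ≡ᵇ b then 1 else 0) ≡ 1
sum-indicator (suc n) zero    _   = cong suc (sum-zero n _ λ _ → refl)
sum-indicator (suc n) (suc b) b<n = sum-indicator n b (s<s⁻¹ b<n)

-- The form in which correlations are bounded: two distinct nonzero terms are two coincidences of
-- the shifted codewords.
sum≤1 : ∀ n (f : Fin n → ℕ) → (∀ i → f i ≤ 1) →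
        (∀ i j → f i ≢ 0 → f j ≢ 0 → i ≡ j) → Vec.sum (tabulate f) ≤ 1
sum≤1 zero    f f≤1 uniq = z≤n
sum≤1 (suc n) f f≤1 uniq with f fzero ≟ 0
... | yes f₀≡0 rewrite f₀≡0 = sum≤1 n (f ∘ fsuc) (f≤1 ∘ fsuc) λ i j fi fj →
  fsuc-injective (uniq (fsuc i) (fsuc j) fi fj)
... | no  f₀≢0 = subst (_≤ 1)
  (sym (trans (cong (λ n → f fzero + n) (sum-zero n (f ∘ fsuc) rest)) (+-identityʳ _))) (f≤1 fzero)
  where
  rest : ∀ i → f (fsuc i) ≡ 0
  rest i with f (fsuc i) ≟ 0
  ... | yes fi≡0 = fi≡0
  ... | no  fi≢0 with uniq fzero (fsuc i) f₀≢0 fi≢0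
  ...   | ()

weight-codeword : ∀ v B → AllPairs _<_ B → All (_< v) B → weight (codeword v B) ≡ length B
weight-codeword v B B< B<v = trans
  (cong Vec.sum (sym (Vec.tabulate-∘ toℕ λ (i : Fin v) → bit (toℕ i) B))) (go B B< B<v)
  where
  go : ∀ B → AllPairs _<_ B → All (_< v) B → Vec.sum (tabulate {n = v} λ i → toℕ (bit (toℕ i) B)) ≡ length B
  go []      _         _           = sum-zero v _ λ _ → refl
  go (b ∷ B) (b< ∷ B<) (b<v ∷ B<v) = trans
    (cong Vec.sum (Vec.tabulate-cong {n = v} λ i → bit-∷ (toℕ i) b B λ b∈ → <⇒≢ (All.lookup b< b∈) refl))
    (trans (sum-+ v (λ i → if toℕ i ≡ᵇ b then 1 else 0) (λ i → toℕ (bit (toℕ i) B)))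
      (cong₂ _+_ (sum-indicator v b b<v) (go B B< B<v)))

codeword⁻ : ∀ {v} B (i : Fin v) → toℕ (lookup (codeword v B) i) ≢ 0 → toℕ i ∈ B
codeword⁻ B i ≢0 = bit⁻ (toℕ i) B (subst (λ x → toℕ x ≢ 0) (Vec.lookup∘tabulate _ i) ≢0)

-- Shifts modulo v

<∧∣⇒≡0 : ∀ {v} (z : ℤ) → ∣ z ∣ * v < v → z ≡ + 0
<∧∣⇒≡0 {v} z h with ∣ z ∣ in eq
... | zero  = ℤ.∣i∣≡0⇒i≡0 eq
... | suc k = contradiction h (≤⇒≯ (m≤m+n v (k * v)))

-- The multiple z v equals x - y, whose absolute value is below v, so z = 0.
congruent⇒≡ : ∀ {v x y} z → x < v → y < v → + x ≡ + y ℤ.+ z ℤ.* + v → x ≡ y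
congruent⇒≡ {v} {x} {y} z x<v y<v eq = ℤ.+-injective (trans eq (trans
  (cong (λ z → + y ℤ.+ z ℤ.* + v) (<∧∣⇒≡0 z small)) (ℤ.+-identityʳ (+ y))))
  where
  cancel : ∀ a b → (a ℤ.+ b) ℤ.- a ≡ b
  cancel = ℤ-solve-∀
  zv : ∣ z ∣ * v ≡ ∣ x ⊖ y ∣
  zv = trans (sym (ℤ.abs-* z (+ v))) (cong ∣_∣ (trans (sym (cancel (+ y) (z ℤ.* + v)))
    (trans (cong (ℤ._- + y) (sym eq)) (ℤ.m-n≡m⊖n x y))))
  small : ∣ z ∣ * v < v
  small = subst (_< v) (sym zv) (≤-<-trans (ℤ.∣m⊝n∣≤m⊔n x y) (⊔-pres-<m x<v y<v))

module _ {v} .{{_ : NonZero v}} where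

  shift-≡ : ∀ r (i : Fin v) → ∃[ q ] (+ toℕ i ℤ.+ r ≡ + toℕ (shift r i) ℤ.+ q ℤ.* + v)
  shift-≡ r i = (+ toℕ i ℤ.+ r) /ℕ v , subst
    (λ k → + toℕ i ℤ.+ r ≡ + k ℤ.+ (+ toℕ i ℤ.+ r) /ℕ v ℤ.* + v)
    (sym (toℕ-fromℕ< _)) (a≡a%ℕn+[a/ℕn]*n (+ toℕ i ℤ.+ r) v)

  shift-fixed : ∀ r (i : Fin v) → toℕ i ≡ toℕ (shift r i) → + v ∣ℤ r
  shift-fixed r i eq with shift-≡ r i
  ... | q , e = divides ∣ q ∣ (trans (cong ∣_∣ r≡qv) (ℤ.abs-* q (+ v)))
    where
    r≡qv : r ≡ q ℤ.* + v
    r≡qv = ∙-cancelˡ ℤ.+-0-abelianGroup (+ toℕ i) r _ (trans e (cong (λ k → + k ℤ.+ q ℤ.* + v) (sym eq)))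

  -- A shift preserves differences modulo v. Either the order of the two positions survives and so
  -- does the gap d, or the second one wraps past 0 and the reversed gap is v - d. Which case occurs
  -- depends on whether `shift r i` plus d stays below v.
  shift-gap : ∀ r (i i′ : Fin v) → toℕ i < toℕ i′ → let d = toℕ i′ ∸ toℕ i in
              toℕ (shift r i′) ≡ toℕ (shift r i) + d ⊎ toℕ (shift r i) ≡ toℕ (shift r i′) + (v ∸ d)
  shift-gap r i i′ i<i′ with shift-≡ r i | shift-≡ r i′
  ... | q , e | q′ , e′ = split (k + d <? v)
    where
    k  = toℕ (shift r i)
    k′ = toℕ (shift r i′)
    d  = toℕ i′ ∸ toℕ i
    d<v : d < v
    d<v = ≤-<-trans (m∸n≤m _ (toℕ i)) (toℕ<n i′)
    i+d : + toℕ i′ ≡ + toℕ i ℤ.+ + d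
    i+d = cong +_ (sym (m+[n∸m]≡n (<⇒≤ i<i′)))
    rearr : ∀ a r d → (a ℤ.+ d) ℤ.+ r ≡ (a ℤ.+ r) ℤ.+ d
    rearr = ℤ-solve-∀
    rearr′ : ∀ k′ k d q q′ v → k′ ℤ.+ q′ ℤ.* v ≡ (k ℤ.+ q ℤ.* v) ℤ.+ d →
             k′ ≡ (k ℤ.+ d) ℤ.+ (q ℤ.- q′) ℤ.* v
    rearr′ k′ k d q q′ v eq = trans (l k′ (q′ ℤ.* v)) (trans (cong (ℤ._- q′ ℤ.* v) eq) (m k d q q′ v))
      where
      l : ∀ a b → a ≡ (a ℤ.+ b) ℤ.- b
      l = ℤ-solve-∀
      m : ∀ k d q q′ v → ((k ℤ.+ q ℤ.* v) ℤ.+ d) ℤ.- q′ ℤ.* v ≡ (k ℤ.+ d) ℤ.+ (q ℤ.- q′) ℤ.* v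
      m = ℤ-solve-∀
    k′≡ : + k′ ≡ + (k + d) ℤ.+ (q ℤ.- q′) ℤ.* + v
    k′≡ = rearr′ (+ k′) (+ k) (+ d) q q′ (+ v) (trans (sym e′) (trans (cong (ℤ._+ r) i+d)
      (trans (rearr (+ toℕ i) r (+ d)) (cong (ℤ._+ + d) e))))
    one-more : ∀ a b z v → a ≡ b ℤ.+ v → a ℤ.+ z ℤ.* v ≡ b ℤ.+ (z ℤ.+ + 1) ℤ.* v
    one-more a b z v refl = n b z v
      where
      n : ∀ b z v → (b ℤ.+ v) ℤ.+ z ℤ.* v ≡ b ℤ.+ (z ℤ.+ + 1) ℤ.* v
      n = ℤ-solve-∀
    split : _ → _
    split (yes k+d<v) = inj₁ (congruent⇒≡ (q ℤ.- q′) (toℕ<n (shift r i′)) k+d<v k′≡)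
    split (no  k+d≮v) = inj₂ (sym (trans (cong (_+ (v ∸ d)) k′≡k+d∸v) unwrap))
      where
      v≤k+d = ≮⇒≥ k+d≮v
      k+d∸v<v : (k + d) ∸ v < v
      k+d∸v<v = +-cancelʳ-< v _ _ (subst (_< v + v) (sym (m∸n+n≡m v≤k+d)) (+-mono-< (toℕ<n (shift r i)) d<v))
      -- Taking v out of k + d adds one to the multiple of v, hence the quotient q - q′ + 1.
      k′≡k+d∸v : k′ ≡ (k + d) ∸ v
      k′≡k+d∸v = congruent⇒≡ (q ℤ.- q′ ℤ.+ + 1) (toℕ<n (shift r i′)) k+d∸v<v (trans k′≡
        (one-more (+ (k + d)) (+ (k + d ∸ v)) (q ℤ.- q′) (+ v) (cong +_ (sym (m∸n+n≡m v≤k+d)))))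
      unwrap : (k + d ∸ v) + (v ∸ d) ≡ k
      unwrap = +-cancelʳ-≡ d _ _ (begin
        ((k + d ∸ v) + (v ∸ d)) + d ≡⟨ +-assoc (k + d ∸ v) _ d ⟩
        (k + d ∸ v) + ((v ∸ d) + d) ≡⟨ cong (λ n → (k + d ∸ v) + n) (m∸n+n≡m (<⇒≤ d<v)) ⟩
        (k + d ∸ v) + v             ≡⟨ m∸n+n≡m v≤k+d ⟩
        k + d                       ∎)
        where open ≡-Reasoning

  -- Correlations in a packing

  module _ {k 𝓑} (packing : IsPacking v k 𝓑) where
    open IsPacking packing

    -- All distances in the packing are distinct, so a distance determines its block and its pair.
    same-pair : ∀ {B B′ p q} → B ∈ 𝓑 → B′ ∈ 𝓑 → p ∈ pairs B → q ∈ pairs B′ →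
                dist v p ≡ dist v q → B ≡ B′ × p ≡ q
    same-pair B∈ B′∈ p∈ q∈ eq with lookup-pair separated B∈ B′∈
    ... | inj₂ (inj₁ s) = contradiction eq (All.lookup (All.lookup s p∈) q∈)
    ... | inj₂ (inj₂ s) = contradiction (sym eq) (All.lookup (All.lookup s q∈) p∈)
    ... | inj₁ refl with lookup-pair (IsBlock.spread (All.lookup blocks B∈)) p∈ q∈
    ...   | inj₁ p≡q      = refl , p≡q
    ...   | inj₂ (inj₁ ≢) = contradiction eq ≢
    ...   | inj₂ (inj₂ ≢) = contradiction (sym eq) ≢

    -- The shift carries the pair (i, i′) to a pair at the same cyclic distance, and `same-pair`
    -- identifies the two. If the order is preserved, i is fixed by the shift, so v divides r.
    coincidence : ∀ {B B′} → B ∈ 𝓑 → B′ ∈ 𝓑 → ∀ r (i i′ : Fin v) → toℕ i < toℕ i′ →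
                  toℕ i ∈ B → toℕ i′ ∈ B → toℕ (shift r i) ∈ B′ → toℕ (shift r i′) ∈ B′ →
                  B ≡ B′ × + v ∣ℤ r
    coincidence {B} {B′} B∈ B′∈ r i i′ i<i′ i∈ i′∈ k∈ k′∈ with shift-gap r i i′ i<i′
    ... | inj₁ k′≡k+d = B≡B′ , shift-fixed r i (cong proj₁ p≡q)
      where
      d = toℕ i′ ∸ toℕ i
      j = toℕ (shift r i)
      j<k′ : j < toℕ (shift r i′)
      j<k′ = subst (j <_) (sym k′≡k+d) (m<m+n j (m<n⇒0<n∸m i<i′))
      found = same-pair B∈ B′∈
        (∈-pairs (IsBlock.increasing (All.lookup blocks B∈)) i∈ i′∈ i<i′)
        (∈-pairs (IsBlock.increasing (All.lookup blocks B′∈)) k∈ k′∈ j<k′)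
        (cong (fold v) (sym (trans (cong (_∸ j) k′≡k+d) (m+n∸m≡n j d))))
      B≡B′ = proj₁ found
      p≡q  = proj₂ found
    -- Here the shift reverses the pair; identifying it with the original one gives d = v - d,
    -- against `halved`.
    ... | inj₂ k≡k′+[v∸d] = contradiction 2d≡v (<⇒≢ 2d<v)
      where
      d  = toℕ i′ ∸ toℕ i
      k′ = toℕ (shift r i′)
      d<v : d < v
      d<v = ≤-<-trans (m∸n≤m _ (toℕ i)) (toℕ<n i′)
      k′<k : k′ < toℕ (shift r i)
      k′<k = subst (k′ <_) (sym k≡k′+[v∸d]) (m<m+n k′ (m<n⇒0<n∸m d<v))
      gap : toℕ (shift r i) ∸ k′ ≡ v ∸ d
      gap = trans (cong (_∸ k′) k≡k′+[v∸d]) (m+n∸m≡n k′ _)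
      p∈ = ∈-pairs (IsBlock.increasing (All.lookup blocks B∈)) i∈ i′∈ i<i′
      p≡q = proj₂ (same-pair B∈ B′∈ p∈
        (∈-pairs (IsBlock.increasing (All.lookup blocks B′∈)) k′∈ k∈ k′<k)
        (sym (trans (cong (fold v) gap) (fold-∸ (<⇒≤ d<v)))))
      d≡v∸d : d ≡ v ∸ d
      d≡v∸d = trans (cong (λ p → proj₂ p ∸ proj₁ p) p≡q) gap
      2d≡v : 2 * d ≡ v
      2d≡v = trans (cong (λ n → d + n) (+-identityʳ d))
        (trans (cong (λ n → d + n) d≡v∸d) (m+[n∸m]≡n (<⇒≤ d<v)))
      2d<v : 2 * d < v
      2d<v = subst (λ e → 2 * e < v) (trans (cong (d ⊓_) (sym d≡v∸d)) (⊓-idem d))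
        (All.lookup (IsBlock.halved (All.lookup blocks B∈)) p∈)

    correlation≤1 : ∀ {B B′} → B ∈ 𝓑 → B′ ∈ 𝓑 → ∀ r → B ≢ B′ ⊎ ¬ (+ v ∣ℤ r) →
                    correlation (codeword v B) (codeword v B′) r ≤ 1
    correlation≤1 {B} {B′} B∈ B′∈ r distinct = sum≤1 v _
      (λ i → *-mono-≤ (bit≤1 (lookup (codeword v B) i)) (bit≤1 (lookup (codeword v B′) (shift r i)))) unique
      where
      x = codeword v B
      y = codeword v B′
      excluded : ¬ (B ≡ B′ × + v ∣ℤ r)
      excluded (B≡B′ , v∣r) = [ (λ B≢B′ → B≢B′ B≡B′) , (λ v∤r → v∤r v∣r) ]′ distinct
      left : ∀ i → toℕ (lookup x i) * toℕ (lookup y (shift r i)) ≢ 0 → toℕ i ∈ B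
      left i ≢0 = codeword⁻ B i λ e → ≢0 (cong (_* toℕ (lookup y (shift r i))) e)
      right : ∀ i → toℕ (lookup x i) * toℕ (lookup y (shift r i)) ≢ 0 → toℕ (shift r i) ∈ B′
      right i ≢0 = codeword⁻ B′ (shift r i) λ e →
        ≢0 (trans (cong (toℕ (lookup x i) *_) e) (*-zeroʳ (toℕ (lookup x i))))
      unique : ∀ i j → _ → _ → i ≡ j
      unique i j fi fj with <-cmp (toℕ i) (toℕ j)
      ... | tri≈ _ i≡j _ = toℕ-injective i≡j
      ... | tri< i<j _ _ = contradiction
        (coincidence B∈ B′∈ r i j i<j (left i fi) (left j fj) (right i fi) (right j fj)) excluded
      ... | tri> _ _ j<i = contradiction
        (coincidence B∈ B′∈ r j i j<i (left j fj) (left i fi) (right j fj) (right i fi)) excluded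

-- From a packing to an optical orthogonal code

codeword-∈ : ∀ {v B B′ i} → codeword v B ≡ codeword v B′ → i < v → i ∈ B → i ∈ B′
codeword-∈ {v} {B} {B′} {i} eq i<v i∈ = subst (_∈ B′) (toℕ-fromℕ< i<v)
  (codeword⁻ B′ j λ e → contradiction (trans (sym e) one) λ ())
  where
  j = fromℕ< i<v
  one : toℕ (lookup (codeword v B′) j) ≡ 1
  one = trans (cong (λ x → toℕ (lookup x j)) (sym eq)) (cong toℕ (trans (Vec.lookup∘tabulate _ j)
    (bit⁺ (toℕ j) B (subst (_∈ B) (sym (toℕ-fromℕ< i<v)) i∈))))

packing⇒IsOOC : ∀ {v} k .{{_ : NonZero v}} {𝓑} → 2 ≤ k → IsPacking v k 𝓑 →
                IsOOC v k (List.map (codeword v) 𝓑)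
packing⇒IsOOC {v} k {𝓑} 2≤k packing = record
  { distinct            = AllPairs.map⁺ (map-with-All apart (All.zip (blocks , sizes)) separated)
  ; constant-weight     = λ x∈ → let B , B∈ , eq = ∈-map⁻ _ x∈ ; ok = All.lookup blocks B∈ in
      trans (cong weight eq) (trans (weight-codeword v B (IsBlock.increasing ok) (IsBlock.bounded ok))
        (All.lookup sizes B∈))
  ; bounded-correlation = bounded
  }
  where
  open IsPacking packing
  -- Since k is at least 2, a block has a pair of marks. A block with the same codeword would
  -- contain that pair too, and its distance would occur in both blocks.
  apart : ∀ {B B′} → IsBlock v B × length B ≡ k → IsBlock v B′ × length B′ ≡ k →
          Separated v B B′ → codeword v B ≢ codeword v B′
  apart {[]}     (_ , e) _ _ _ = contradiction (subst (2 ≤_) (sym e) 2≤k) λ ()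
  apart {_ ∷ []} (_ , e) _ _ _ = contradiction (subst (2 ≤_) (sym e) 2≤k) λ { (s≤s ()) }
  apart {a ∷ b ∷ B} {B′} (ok , _) (ok′ , _) sep eq with IsBlock.increasing ok | IsBlock.bounded ok
  ... | (a<b ∷ _) ∷ _ | a<v ∷ b<v ∷ _ = All.lookup (All.head sep)
    (∈-pairs (IsBlock.increasing ok′) (codeword-∈ {B = a ∷ b ∷ B} {B′} eq a<v (here refl))
      (codeword-∈ {B = a ∷ b ∷ B} {B′} eq b<v (there (here refl))) a<b) refl
  bounded : ∀ {x y} → x ∈ List.map (codeword v) 𝓑 → y ∈ List.map (codeword v) 𝓑 →
            ∀ r → x ≢ y ⊎ ¬ (+ v ∣ℤ r) → correlation x y r ≤ 1
  bounded x∈ y∈ r h with ∈-map⁻ _ x∈ | ∈-map⁻ _ y∈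
  ... | B , B∈ , refl | B′ , B′∈ , refl = correlation≤1 packing B∈ B′∈ r
    ([ (λ x≢y → inj₁ λ { refl → x≢y refl }) , inj₂ ]′ h)

-- Linear functions of m and arithmetic progressions

Linear : Set
Linear = ℕ × ℕ

_at_ : Linear → ℕ → ℕ
(a , b) at m = a * m + b

-- Comparison of coefficients is decidable and suffices for the inequality at every natural m.
_≼_ _≺_ : Linear → Linear → Set
(a , b) ≼ (c , d) = a ≤ c × b ≤ d
(a , b) ≺ (c , d) = a ≤ c × b < d

_≼?_ : ∀ f g → Dec (f ≼ g)
(a , b) ≼? (c , d) = a ≤? c ×-dec b ≤? d

_≺?_ : ∀ f g → Dec (f ≺ g)
(a , b) ≺? (c , d) = a ≤? c ×-dec b <? d

≺-sound : ∀ f g m → f ≺ g → f at m < g at m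
≺-sound (a , b) (c , d) m (a≤c , b<d) = +-mono-≤-< (*-monoˡ-≤ m a≤c) b<d

twice : Linear → Linear
twice (a , b) = 2 * a , 2 * b

twice-at : ∀ f m → twice f at m ≡ 2 * (f at m)
twice-at (a , b) m = lemma a b m
  where
  lemma : ∀ a b m → 2 * a * m + 2 * b ≡ 2 * (a * m + b)
  lemma = solve-∀

-- ⟦ F ⟧ m i j is a value at parameter m.  The terms of a progression of length
-- e at m + 1 are obtained from i + j = e at m, so that p and q hold a positive and
-- a negative slope and no subtraction occurs.
record Form : Set where
  constructor form
  field
    a b p q : ℕ

⟦_⟧ : Form → ℕ → ℕ → ℕ → ℕ
⟦ form a b p q ⟧ m i j = a * m + b + (p * i + q * j)

_⊕_ : Form → Form → Form
form a b p q ⊕ form a′ b′ p′ q′ = form (a + a′) (b + b′) (p + p′) (q + q′)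

⊕-sound : ∀ F G m i j → ⟦ F ⊕ G ⟧ m i j ≡ ⟦ F ⟧ m i j + ⟦ G ⟧ m i j
⊕-sound (form a b p q) (form a′ b′ p′ q′) = lemma a b p q a′ b′ p′ q′
  where
  lemma : ∀ a b p q a′ b′ p′ q′ m i j →
          (a + a′) * m + (b + b′) + ((p + p′) * i + (q + q′) * j) ≡
          (a * m + b + (p * i + q * j)) + (a′ * m + b′ + (p′ * i + q′ * j))
  lemma = solve-∀

infixl 6 _⊕_

low : Form → Linear
low (form a b p q) = a , b

low-≤ : ∀ F m i j → low F at m ≤ ⟦ F ⟧ m i j
low-≤ (form a b p q) m i j = m≤m+n _ _

-- Disjointness of progressions

-- When g divides all slopes, every value at m is congruent to `a * m + b` modulo g. If the
-- coefficients a agree modulo g and the b do not, the two classes differ for every m. This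
-- separates interleaved progressions, whose ranges overlap.
Residues : (g : ℕ) .{{_ : NonZero g}} → Form → Form → Set
Residues g (form a b p q) (form a′ b′ p′ q′) =
  (p % g ≡ 0 × q % g ≡ 0 × p′ % g ≡ 0 × q′ % g ≡ 0) × a % g ≡ a′ % g × b % g ≢ b′ % g

residues? : ∀ g .{{_ : NonZero g}} F G → Dec (Residues g F G)
residues? g (form a b p q) (form a′ b′ p′ q′) =
  (p % g ≟ 0 ×-dec q % g ≟ 0 ×-dec p′ % g ≟ 0 ×-dec q′ % g ≟ 0) ×-dec
  a % g ≟ a′ % g ×-dec ¬? (b % g ≟ b′ % g)

-- With g = k + 1, adding `k * z` to both sides completes z to a multiple of g and takes the place
-- of subtracting z.
+-cancelʳ-% : ∀ x y z g .{{_ : NonZero g}} → (x + z) % g ≡ (y + z) % g → x % g ≡ y % g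
+-cancelʳ-% x y z g@(suc k) eq = trans (sym (complete x)) (trans step (complete y))
  where
  complete : ∀ x → (x + z + k * z) % g ≡ x % g
  complete x = trans (cong (_% g) (trans (+-assoc x z _) (cong (λ n → x + n) (*-comm g z))))
    ([m+kn]%n≡m%n x z g)
  step : (x + z + k * z) % g ≡ (y + z + k * z) % g
  step = begin
    (x + z + k * z) % g               ≡⟨ %-distribˡ-+ (x + z) _ g ⟩
    ((x + z) % g + (k * z) % g) % g   ≡⟨ cong (λ n → (n + (k * z) % g) % g) eq ⟩
    ((y + z) % g + (k * z) % g) % g   ≡⟨ %-distribˡ-+ (y + z) _ g ⟨
    (y + z + k * z) % g               ∎
    where open ≡-Reasoning

value-% : ∀ g .{{_ : NonZero g}} a b p q m i j → p % g ≡ 0 → q % g ≡ 0 →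
          (a * m + b + (p * i + q * j)) % g ≡ (b + a % g * m) % g
value-% g a b p q m i j p≡0 q≡0 = trans (cong (_% g) (begin
  a * m + b + (p * i + q * j)
    ≡⟨ cong₂ (λ a n → a * m + b + n) (m≡m%n+[m/n]*n a g)
         (cong₂ (λ p q → p * i + q * j) (multiple p p≡0) (multiple q q≡0)) ⟩
  (a % g + a / g * g) * m + b + (p / g * g * i + q / g * g * j)
    ≡⟨ lemma (a % g) (a / g) (p / g) (q / g) b g m i j ⟩
  b + a % g * m + (a / g * m + (p / g * i + q / g * j)) * g ∎))
  ([m+kn]%n≡m%n (b + a % g * m) (a / g * m + (p / g * i + q / g * j)) g)
  where
  open ≡-Reasoning
  multiple : ∀ p → p % g ≡ 0 → p ≡ p / g * g
  multiple p p≡0 = trans (m≡m%n+[m/n]*n p g) (cong (_+ p / g * g) p≡0)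
  lemma : ∀ r a p q b g m i j → (r + a * g) * m + b + (p * g * i + q * g * j) ≡
                                b + r * m + (a * m + (p * i + q * j)) * g
  lemma = solve-∀

residues-sound : ∀ g .{{_ : NonZero g}} F G → Residues g F G →
                 ∀ m i j i′ j′ → ⟦ F ⟧ m i j ≢ ⟦ G ⟧ m i′ j′
residues-sound g (form a b p q) (form a′ b′ p′ q′) ((p≡0 , q≡0 , p′≡0 , q′≡0) , a≡a′ , b≢b′) m i j i′ j′ eq =
  b≢b′ (+-cancelʳ-% b b′ (a % g * m) g (begin
    (b + a % g * m) % g                    ≡⟨ value-% g a b p q m i j p≡0 q≡0 ⟨
    (a * m + b + (p * i + q * j)) % g      ≡⟨ cong (_% g) eq ⟩
    (a′ * m + b′ + (p′ * i′ + q′ * j′)) % g ≡⟨ value-% g a′ b′ p′ q′ m i′ j′ p′≡0 q′≡0 ⟩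
    (b′ + a′ % g * m) % g                  ≡⟨ cong (λ r → (b′ + r * m) % g) a≡a′ ⟨
    (b′ + a % g * m) % g                   ∎))
  where open ≡-Reasoning

-- Bounds p i + q j by (p + q) (i + j). Once p or q is zero this is the exact maximum over the index
-- range.
high : Linear → Form → Linear
high (c , l) (form a b p q) = a + (p + q) * c , b + (p + q) * l

≤-high : ∀ ends F m i j → i + j ≡ ends at m → ⟦ F ⟧ m i j ≤ high ends F at m
≤-high (c , l) (form a b p q) m i j eq = begin
  a * m + b + (p * i + q * j)                   ≤⟨ m≤m+n _ (q * i + p * j) ⟩
  a * m + b + (p * i + q * j) + (q * i + p * j) ≡⟨ lemma a b p q m i j ⟩
  a * m + b + (p + q) * (i + j)                 ≡⟨ cong (λ n → a * m + b + (p + q) * n) eq ⟩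
  a * m + b + (p + q) * (c * m + l)             ≡⟨ lemma′ a b (p + q) c l m ⟩
  (a + (p + q) * c) * m + (b + (p + q) * l)     ∎
  where
  open ≤-Reasoning
  lemma : ∀ a b p q m i j → a * m + b + (p * i + q * j) + (q * i + p * j) ≡
                            a * m + b + (p + q) * (i + j)
  lemma = solve-∀
  lemma′ : ∀ a b s c l m → a * m + b + s * (c * m + l) ≡ (a + s * c) * m + (b + s * l)
  lemma′ = solve-∀

Disjoint : Linear → Linear → Form → Form → Set
Disjoint e e′ F G = high e F ≺ low G ⊎ high e′ G ≺ low F ⊎ Residues 2 F G ⊎ Residues 3 F G

disjoint? : ∀ e e′ F G → Dec (Disjoint e e′ F G)
disjoint? e e′ F G = high e F ≺? low G ⊎-dec high e′ G ≺? low F ⊎-dec residues? 2 F G ⊎-dec residues? 3 F G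

-- The two indices are independent, so a single check covers two pairs of one block as well as pairs
-- of different blocks.
disjoint-sound : ∀ e F e′ G → Disjoint e e′ F G → ∀ m i j i′ j′ →
                 i + j ≡ e at m → i′ + j′ ≡ e′ at m → ⟦ F ⟧ m i j ≢ ⟦ G ⟧ m i′ j′
disjoint-sound e F e′ G (inj₁ F≺G) m i j i′ j′ eq eq′ = <⇒≢
  (≤-<-trans (≤-high e F m i j eq) (<-≤-trans (≺-sound _ _ m F≺G) (low-≤ G m i′ j′)))
disjoint-sound e F e′ G (inj₂ (inj₁ G≺F)) m i j i′ j′ eq eq′ = ≢-sym (<⇒≢
  (≤-<-trans (≤-high e′ G m i′ j′ eq′) (<-≤-trans (≺-sound _ _ m G≺F) (low-≤ F m i j))))
disjoint-sound e F e′ G (inj₂ (inj₂ (inj₁ res))) m i j i′ j′ _ _ = residues-sound 2 F G res m i j i′ j′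
disjoint-sound e F e′ G (inj₂ (inj₂ (inj₂ res))) m i j i′ j′ _ _ = residues-sound 3 F G res m i j i′ j′

-- With i + j fixed, raising i by δ lowers j by δ and changes the value by (p - q) δ. The first
-- alternative is an index range with the single member 0.
Injective : Linear → Form → Set
Injective (c , l) (form _ _ p q) = (c ≡ 0 × l ≡ 0) ⊎ p ≢ q

injective? : ∀ e F → Dec (Injective e F)
injective? (c , l) (form _ _ p q) = (c ≟ 0 ×-dec l ≟ 0) ⊎-dec ¬? (p ≟ q)

injective-sound : ∀ e F → Injective e F → ∀ m i j i′ j′ → i + j ≡ e at m → i′ + j′ ≡ e at m →
                  i < i′ → ⟦ F ⟧ m i j ≢ ⟦ F ⟧ m i′ j′
injective-sound (c , l) (form a b p q) (inj₁ (refl , refl)) m i j i′ j′ _ eq′ i<i′ =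
  contradiction (m+n≡0⇒m≡0 i′ eq′) (≢-sym (<⇒≢ (≤-<-trans z≤n i<i′)))
injective-sound (c , l) (form a b p q) (inj₂ p≢q) m i j i′ j′ eq eq′ i<i′ vals =
  p≢q (sym (*-cancelʳ-≡ q p δ {{>-nonZero (m<n⇒0<n∸m i<i′)}} qδ≡pδ))
  where
  δ = i′ ∸ i
  i′≡ : i′ ≡ i + δ
  i′≡ = sym (m+[n∸m]≡n (<⇒≤ i<i′))
  j≡ : j ≡ δ + j′
  j≡ = +-cancelˡ-≡ i _ _ (trans eq (trans (sym eq′) (trans (cong (_+ j′) i′≡) (+-assoc i δ j′))))
  lemma₁ : ∀ p q i j δ → p * i + q * (δ + j) ≡ q * δ + (p * i + q * j)
  lemma₁ = solve-∀
  lemma₂ : ∀ p q i j δ → p * (i + δ) + q * j ≡ p * δ + (p * i + q * j)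
  lemma₂ = solve-∀
  qδ≡pδ : q * δ ≡ p * δ
  qδ≡pδ = +-cancelʳ-≡ (p * i + q * j′) _ _ (begin
    q * δ + (p * i + q * j′) ≡⟨ lemma₁ p q i j′ δ ⟨
    p * i + q * (δ + j′)     ≡⟨ cong (λ j → p * i + q * j) j≡ ⟨
    p * i + q * j            ≡⟨ +-cancelˡ-≡ (a * m + b) _ _ vals ⟩
    p * i′ + q * j′          ≡⟨ cong (λ i → p * i + q * j′) i′≡ ⟩
    p * (i + δ) + q * j′     ≡⟨ lemma₂ p q i j′ δ ⟩
    p * δ + (p * i + q * j′) ∎)
    where open ≡-Reasoning

-- Makes p or q zero, so that low becomes the exact minimum of the progression.
normalise : Linear → Form → Form
normalise (c , l) (form a b p q) = form (a + (p ⊓ q) * c) (b + (p ⊓ q) * l) (p ∸ p ⊓ q) (q ∸ p ⊓ q)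

-- The common slope k = `p ⊓ q` contributes k (i + j), which is linear in m and moves into the
-- coefficients a and b.
normalise-sound : ∀ e F m i j → i + j ≡ e at m → ⟦ normalise e F ⟧ m i j ≡ ⟦ F ⟧ m i j
normalise-sound (c , l) (form a b p q) m i j eq = begin
  (a + k * c) * m + (b + k * l) + ((p ∸ k) * i + (q ∸ k) * j)
    ≡⟨ lemma a b k c l m ((p ∸ k) * i + (q ∸ k) * j) ⟩
  a * m + b + (k * (c * m + l) + ((p ∸ k) * i + (q ∸ k) * j))
    ≡⟨ cong (λ n → a * m + b + (k * n + ((p ∸ k) * i + (q ∸ k) * j))) eq ⟨
  a * m + b + (k * (i + j) + ((p ∸ k) * i + (q ∸ k) * j))
    ≡⟨ cong (λ n → a * m + b + n) (lemma′ k (p ∸ k) (q ∸ k) i j) ⟩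
  a * m + b + ((k + (p ∸ k)) * i + (k + (q ∸ k)) * j)
    ≡⟨ cong₂ (λ p q → a * m + b + (p * i + q * j)) (m+[n∸m]≡n (m⊓n≤m p q)) (m+[n∸m]≡n (m⊓n≤n p q)) ⟩
  a * m + b + (p * i + q * j) ∎
  where
  open ≡-Reasoning
  k = p ⊓ q
  lemma : ∀ a b k c l m n → (a + k * c) * m + (b + k * l) + n ≡ a * m + b + (k * (c * m + l) + n)
  lemma = solve-∀
  lemma′ : ∀ k p q i j → k * (i + j) + (p * i + q * j) ≡ (k + p) * i + (k + q) * j
  lemma′ = solve-∀

-- Folding a progression at v / 2

module _ (modulus : Linear) (ends : Linear) where

  Small : Form → Set
  Small F = twice (high ends F) ≺ modulus

  small? : ∀ F → Dec (Small F)
  small? F = twice (high ends F) ≺? modulus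

  -- Represents v minus the form. Swapping the slopes works because p i + q j and q i + p j add up
  -- to (p + q) (i + j), which `high` already accounts for.
  complement : Form → Form
  complement F@(form a b p q) =
    form (proj₁ modulus ∸ proj₁ (high ends F)) (proj₂ modulus ∸ proj₂ (high ends F)) q p

  select : ∀ F → Dec (Small F) → Form
  select F small = if does small then F else complement F

  fold-form : Form → Form
  fold-form F = select F (small? F)

  -- The whole progression lies on one side of v / 2, the same side for every m, so its folded
  -- values are again given by one form.
  Foldable : Form → Set
  Foldable F = Small F ⊎ (high ends F ≼ modulus × Small (complement F))

  foldable? : ∀ F → Dec (Foldable F)
  foldable? F = small? F ⊎-dec (high ends F ≼? modulus ×-dec small? (complement F))

  module _ (m i j : ℕ) (i+j : i + j ≡ ends at m) where

    small-sound : ∀ F → Small F → 2 * ⟦ F ⟧ m i j < modulus at m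
    small-sound F small = ≤-<-trans (*-monoʳ-≤ 2 (≤-high ends F m i j i+j))
      (subst (_< modulus at m) (twice-at (high ends F) m) (≺-sound _ _ m small))

    complement-sound : ∀ F → high ends F ≼ modulus →
                       ⟦ F ⟧ m i j + ⟦ complement F ⟧ m i j ≡ modulus at m
    complement-sound (form a b p q) (A≤V , B≤w) = begin
      (a * m + b + (p * i + q * j)) + (A′ * m + B′ + (q * i + p * j))
        ≡⟨ lemma a b A′ B′ p q m i j ⟩
      a * m + b + (p + q) * (i + j) + (A′ * m + B′)
        ≡⟨ cong (λ n → a * m + b + (p + q) * n + (A′ * m + B′)) i+j ⟩
      a * m + b + (p + q) * (c * m + l) + (A′ * m + B′)
        ≡⟨ lemma′ a b A′ B′ (p + q) c l m ⟩
      (a + (p + q) * c + A′) * m + (b + (p + q) * l + B′)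
        ≡⟨ cong₂ (λ V w → V * m + w) (m+[n∸m]≡n A≤V) (m+[n∸m]≡n B≤w) ⟩
      proj₁ modulus * m + proj₂ modulus ∎
      where
      open ≡-Reasoning
      c = proj₁ ends
      l = proj₂ ends
      A′ = proj₁ modulus ∸ (a + (p + q) * c)
      B′ = proj₂ modulus ∸ (b + (p + q) * l)
      lemma : ∀ a b A B p q m i j → (a * m + b + (p * i + q * j)) + (A * m + B + (q * i + p * j)) ≡
                                    a * m + b + (p + q) * (i + j) + (A * m + B)
      lemma = solve-∀
      lemma′ : ∀ a b A B s c l m → a * m + b + s * (c * m + l) + (A * m + B) ≡
                                   (a + s * c + A) * m + (b + s * l + B)
      lemma′ = solve-∀

    fold-below : ∀ {v d} → 2 * d < v → fold v d ≡ d
    fold-below {v} {d} 2d<v = m≤n⇒m⊓n≡m (+-cancelˡ-≤ d _ _ (begin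
      d + d       ≡⟨ cong (λ n → d + n) (+-identityʳ d) ⟨
      2 * d       ≤⟨ <⇒≤ 2d<v ⟩
      v           ≡⟨ m+[n∸m]≡n (≤-trans (m≤m+n d (d + 0)) (<⇒≤ 2d<v)) ⟨
      d + (v ∸ d) ∎))
      where open ≤-Reasoning

    fold-form-sound : ∀ F → Foldable F →
                      fold (modulus at m) (⟦ F ⟧ m i j) ≡ ⟦ fold-form F ⟧ m i j ×
                      2 * ⟦ fold-form F ⟧ m i j < modulus at m
    fold-form-sound F foldable = go (small? F) foldable
      where
      v = modulus at m
      d = ⟦ F ⟧ m i j
      e = ⟦ complement F ⟧ m i j
      go : (s : Dec (Small F)) → Foldable F →
           fold v d ≡ ⟦ select F s ⟧ m i j × 2 * ⟦ select F s ⟧ m i j < v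
      go (yes small) _            = fold-below (small-sound F small) , small-sound F small
      go (no ¬small) (inj₁ small) = contradiction small ¬small
      go (no _) (inj₂ (F≼ , small)) = trans (sym (fold-∸ d≤v))
          (trans (cong (fold v) v∸d≡e) (fold-below (small-sound (complement F) small))) ,
        small-sound (complement F) small
        where
        d+e≡v = complement-sound F F≼
        d≤v : d ≤ v
        d≤v = subst (d ≤_) d+e≡v (m≤m+n d e)
        v∸d≡e : v ∸ d ≡ e
        v∸d≡e = trans (cong (_∸ d) (sym d+e≡v)) (m+n∸m≡n d e)

-- Rows: one-parameter families of blocks

-- The index i of the blocks {0, x, x + y, x + y + z} runs from 0 to ends at m
-- inclusive.
record Row : Set where
  constructor row
  field
    ends  : Linear
    x y z : Form

module _ (R : Row) where
  open Row R

  -- Listed in the order in which `pairs` runs through a block of four marks.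
  gaps : List Form
  gaps = x ∷ (x ⊕ y) ∷ (x ⊕ y ⊕ z) ∷ y ∷ (y ⊕ z) ∷ z ∷ []

  differences : List Form
  differences = List.map (normalise ends) gaps

  distances : Linear → List Form
  distances modulus = List.map (fold-form modulus ends) differences

  block : ℕ → ℕ → List ℕ
  block m i = 0 ∷ X ∷ X + Y ∷ X + Y + Z ∷ []
    where
    j = (ends at m) ∸ i
    X = ⟦ x ⟧ m i j
    Y = ⟦ y ⟧ m i j
    Z = ⟦ z ⟧ m i j

  expand : ℕ → List (List ℕ)
  expand m = applyUpTo (block m) (suc (ends at m))

  -- Conditions on coefficients alone, which hold the row together for every m: `disjoint` separates
  -- different pairs at any two indices, `injective` the same pair at different indices. In
  -- `bounded` the form is normalised first so that `high` is its exact maximum.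
  record Valid (modulus : Linear) : Set where
    constructor valid
    field
      positive  : All (λ F → 0 < Form.b F) (x ∷ y ∷ z ∷ [])
      bounded   : high ends (normalise ends (x ⊕ y ⊕ z)) ≺ modulus
      foldable  : All (Foldable modulus ends) differences
      disjoint  : AllPairs (Disjoint ends ends) (distances modulus)
      injective : All (Injective ends) (distances modulus)

valid? : ∀ modulus R → Dec (Valid R modulus)
valid? modulus R = map′ (λ (a , b , c , d , e) → valid a b c d e)
  (λ (valid a b c d e) → a , b , c , d , e)
  (All.all? (λ F → 0 <? Form.b F) _ ×-dec _ ≺? _ ×-dec All.all? (foldable? modulus (Row.ends R)) _
    ×-dec AllPairs.allPairs? (disjoint? _ _) _ ×-dec All.all? (injective? _) _)

-- Designs and their decidable conditions

Design : Set
Design = List Row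

-- A row has `rate * m + count` blocks; the `suc` in `count` is there because `ends` is the last
-- index, counted from 0.
rate : Row → ℕ
rate R = proj₁ (Row.ends R)

count : Row → ℕ
count R = suc (proj₂ (Row.ends R))

size : Design → Linear
size D = sum (List.map rate D) , sum (List.map count D)

modulus : ℕ → Design → Linear
modulus c D = 12 * proj₁ (size D) , 12 * proj₂ (size D) + c

Apart : Linear × List Form → Linear × List Form → Set
Apart (e , Fs) (e′ , Gs) = All (λ F → All (Disjoint e e′ F) Gs) Fs

Works : ℕ → Design → Set
Works c D = All (λ R → Valid R (modulus c D)) D ×
  AllPairs Apart (List.map (λ R → Row.ends R , distances R (modulus c D)) D)

works? : ∀ c D → Dec (Works c D)
works? c D = All.all? (valid? (modulus c D)) D ×-dec
  AllPairs.allPairs? (λ (e , Fs) (e′ , Gs) → All.all? (λ F → All.all? (disjoint? e e′ F) Gs) Fs) _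

-- Soundness of the conditions at a given m

module _ (R : Row) (μ : Linear) (m : ℕ) where
  open Row R
  private
    v = μ at m

  values : ℕ → List ℕ
  values i = List.map (λ F → ⟦ F ⟧ m i ((ends at m) ∸ i)) (distances R μ)

  module _ (ok : Valid R μ) where
    open Valid ok

    -- The bridge between blocks and forms: through this equation the conditions on the six folded
    -- forms become conditions on the actual distances.
    dists : ∀ i → i ≤ ends at m → List.map (dist v) (pairs (block R m i)) ≡ values i
    dists i i≤ = trans (cong (List.map (fold v)) raw) (folded (gaps R) foldable)
      where
      j = (ends at m) ∸ i
      i+j = m+[n∸m]≡n i≤
      X = ⟦ x ⟧ m i j
      Y = ⟦ y ⟧ m i j
      Z = ⟦ z ⟧ m i j
      raw : X ∷ (X + Y) ∷ (X + Y + Z) ∷ (X + Y ∸ X) ∷ (X + Y + Z ∸ X) ∷ (X + Y + Z ∸ (X + Y)) ∷ [] ≡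
            List.map (λ F → ⟦ F ⟧ m i j) (gaps R)
      raw = cong (X ∷_) (cong₂ _∷_ (sym (⊕-sound x y m i j)) (cong₂ _∷_ xyz
        (cong₂ _∷_ (m+n∸m≡n X Y) (cong₂ _∷_ yz (cong (_∷ []) (m+n∸m≡n (X + Y) Z))))))
        where
        xyz : X + Y + Z ≡ ⟦ x ⊕ y ⊕ z ⟧ m i j
        xyz = trans (cong (_+ Z) (sym (⊕-sound x y m i j))) (sym (⊕-sound (x ⊕ y) z m i j))
        yz : X + Y + Z ∸ X ≡ ⟦ y ⊕ z ⟧ m i j
        yz = trans (cong (_∸ X) (+-assoc X Y Z)) (trans (m+n∸m≡n X (Y + Z)) (sym (⊕-sound y z m i j)))
      folded : ∀ Fs → All (Foldable μ ends) (List.map (normalise ends) Fs) →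
               List.map (fold v) (List.map (λ F → ⟦ F ⟧ m i j) Fs) ≡
               List.map (λ F → ⟦ F ⟧ m i j) (List.map (fold-form μ ends) (List.map (normalise ends) Fs))
      folded []       []       = refl
      folded (F ∷ Fs) (f ∷ fs) = cong₂ _∷_
        (trans (cong (fold v) (sym (normalise-sound ends F m i j i+j)))
          (proj₁ (fold-form-sound μ ends m i j i+j (normalise ends F) f)))
        (folded Fs fs)

    isBlock : ∀ i → i ≤ ends at m → IsBlock v (block R m i)
    isBlock i i≤ = record
      { increasing = chain
      ; bounded    = 0<v ∷ ≤-<-trans X≤XYZ XYZ<v ∷ ≤-<-trans (m≤m+n _ Z) XYZ<v ∷ XYZ<v ∷ []
      ; halved     = All.map⁻ {f = dist v} (subst (All (λ d → 2 * d < v)) (sym (dists i i≤))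
          (halves (differences R) foldable))
      ; spread     = AllPairs.map⁻ {f = dist v} (subst (AllPairs _≢_) (sym (dists i i≤))
          (AllPairs.map⁺ (AllPairs.map (λ {F} {G} d →
            disjoint-sound ends F ends G d m i j i j i+j i+j) disjoint)))
      }
      where
      j = (ends at m) ∸ i
      i+j = m+[n∸m]≡n i≤
      X = ⟦ x ⟧ m i j
      Y = ⟦ y ⟧ m i j
      Z = ⟦ z ⟧ m i j
      pos : ∀ F → 0 < Form.b F → 0 < ⟦ F ⟧ m i j
      pos F b>0 = ≤-trans (≤-trans b>0 (m≤n+m _ _)) (low-≤ F m i j)
      0<X = pos x (All.head positive)
      0<Y = pos y (All.head (All.tail positive))
      0<Z = pos z (All.head (All.tail (All.tail positive)))
      X<XY : X < X + Y
      X<XY = m<m+n X 0<Y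
      XY<XYZ : X + Y < X + Y + Z
      XY<XYZ = m<m+n (X + Y) 0<Z
      X≤XYZ = <⇒≤ (<-trans X<XY XY<XYZ)
      chain : AllPairs _<_ (block R m i)
      chain = (0<X ∷ <-trans 0<X X<XY ∷ <-trans 0<X (<-trans X<XY XY<XYZ) ∷ [])
            ∷ (X<XY ∷ <-trans X<XY XY<XYZ ∷ []) ∷ (XY<XYZ ∷ []) ∷ [] ∷ []
      XYZ<v : X + Y + Z < v
      XYZ<v = subst (_< v) (trans (normalise-sound ends (x ⊕ y ⊕ z) m i j i+j)
          (trans (⊕-sound (x ⊕ y) z m i j) (cong (_+ Z) (⊕-sound x y m i j))))
        (≤-<-trans (≤-high ends (normalise ends (x ⊕ y ⊕ z)) m i j i+j) (≺-sound _ _ m bounded))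
      0<v = ≤-<-trans z≤n XYZ<v
      halves : ∀ Fs → All (Foldable μ ends) Fs → All (λ d → 2 * d < v)
        (List.map (λ F → ⟦ F ⟧ m i j) (List.map (fold-form μ ends) Fs))
      halves []       []       = []
      halves (F ∷ Fs) (f ∷ fs) = proj₂ (fold-form-sound μ ends m i j i+j F f) ∷ halves Fs fs

module _ (μ : Linear) (m : ℕ) where
  private
    v = μ at m

  separated : ∀ R R′ → Valid R μ → Valid R′ μ → ∀ {i i′} →
              i ≤ Row.ends R at m → i′ ≤ Row.ends R′ at m →
              All (λ F → All (λ G → ⟦ F ⟧ m i ((Row.ends R at m) ∸ i) ≢
                                    ⟦ G ⟧ m i′ ((Row.ends R′ at m) ∸ i′)) (distances R′ μ)) (distances R μ) →
              Separated v (block R m i) (block R′ m i′)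
  separated R R′ ok ok′ {i} {i′} i≤ i′≤ h = All.map (All.map⁻ {f = dist v}) (All.map⁻ {f = dist v}
    (subst (All (λ d → All (d ≢_) (List.map (dist v) (pairs (block R′ m i′))))) (sym (dists R μ m ok i i≤))
      (subst (λ ds → All (λ d → All (d ≢_) ds) (values R μ m i)) (sym (dists R′ μ m ok′ i′ i′≤))
        (All.map⁺ (All.map All.map⁺ h)))))

  across : ∀ R R′ → Valid R μ → Valid R′ μ → ∀ {i i′} → i ≤ Row.ends R at m → i′ ≤ Row.ends R′ at m →
           All (λ F → All (Disjoint (Row.ends R) (Row.ends R′) F) (distances R′ μ)) (distances R μ) →
           Separated v (block R m i) (block R′ m i′)
  across R R′ ok ok′ i≤ i′≤ ds = separated R R′ ok ok′ i≤ i′≤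
    (All.map (λ {F} → All.map λ {G} d → disjoint-sound (Row.ends R) F (Row.ends R′) G d m _ _ _ _
      (m+[n∸m]≡n i≤) (m+[n∸m]≡n i′≤)) ds)

  -- Of the 36 comparisons between two blocks of a row, the six on the diagonal follow from
  -- `injective`, the others from `disjoint`, used with the two indices in either order.
  within : ∀ R → Valid R μ → ∀ {i i′} → i < i′ → i′ ≤ Row.ends R at m →
           Separated v (block R m i) (block R m i′)
  within R ok {i} {i′} i<i′ i′≤ = separated R R ok ok i≤ i′≤ (AllPairs⇒All²
    (All.map (λ {F} inj → injective-sound e F inj m i _ i′ _ i+j i′+j′ i<i′) injective)
    (AllPairs.map (λ {F} {G} d → disjoint-sound e F e G d m i _ i′ _ i+j i′+j′ ,
      ≢-sym (disjoint-sound e F e G d m i′ _ i _ i′+j′ i+j)) disjoint))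
    where
    open Valid ok
    e = Row.ends R
    i≤ = ≤-trans (<⇒≤ i<i′) i′≤
    i+j = m+[n∸m]≡n i≤
    i′+j′ = m+[n∸m]≡n i′≤

-- From a design to an optimal code

blocks-of : Design → ℕ → List (List ℕ)
blocks-of D m = concat (List.map (λ R → expand R m) D)

works⇒packing : ∀ c D → Works c D → ∀ m → IsPacking (modulus c D at m) 4 (blocks-of D m)
works⇒packing c D (valids , ds) m = record
  { blocks    = All.concat⁺ (All.map⁺ (All.map (λ {R} ok → All.applyUpTo⁺₁ (block R m) _
                  λ i< → isBlock R μ m ok _ (s≤s⁻¹ i<)) valids))
  ; sizes     = All.concat⁺ (All.map⁺ (All.universal (λ R → All.applyUpTo⁺₂ (block R m) _ λ _ → refl) D))
  ; separated = AllPairs.concat⁺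
      (All.map⁺ (All.map (λ {R} ok → AllPairs.applyUpTo⁺₁ (block R m) _
        λ i<i′ i′< → within μ m R ok i<i′ (s≤s⁻¹ i′<)) valids))
      (AllPairs.map⁺ (map-with-All (λ {R} {R′} ok ok′ d →
        All.applyUpTo⁺₁ (block R m) _ λ i< → All.applyUpTo⁺₁ (block R′ m) _ λ i′< →
          across μ m R R′ ok ok′ (s≤s⁻¹ i<) (s≤s⁻¹ i′<) d) valids (AllPairs.map⁻ ds)))
  }
  where
  μ = modulus c D

length-blocks-of : ∀ D m → length (blocks-of D m) ≡ size D at m
length-blocks-of []      m = refl
length-blocks-of (R ∷ D) m = begin
  length (expand R m List.++ blocks-of D m)               ≡⟨ List.length-++ (expand R m) ⟩
  length (expand R m) + length (blocks-of D m)
    ≡⟨ cong₂ _+_ (List.length-applyUpTo (block R m) (suc (Row.ends R at m))) (length-blocks-of D m) ⟩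
  suc (Row.ends R at m) + (size D at m)                   ≡⟨ lemma (rate R) (proj₂ (Row.ends R)) _ _ m ⟩
  size (R ∷ D) at m                                       ∎
  where
  open ≡-Reasoning
  lemma : ∀ a b c d m → suc (a * m + b) + (c * m + d) ≡ (a + c) * m + (suc b + d)
  lemma = solve-∀

-- With t blocks, v - 1 = 12 t + c. As c is below 12 = 4 · 3, the prescribed size is exactly t.
optimal : ∀ c → c < 12 → ∀ D → Works (suc c) D → ∀ m v .{{_ : NonZero v}} →
          v ≡ modulus (suc c) D at m → ∃[ C ] IsOptimalOOC v 4 C
optimal c c<12 D works m v refl = List.map (codeword v) 𝓑 , record
  { isOOC = packing⇒IsOOC 4 (s≤s (s≤s z≤n)) (works⇒packing (suc c) D works m)
  ; size  = begin
      length (List.map (codeword v) 𝓑) ≡⟨ List.length-map (codeword v) 𝓑 ⟩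
      length 𝓑                         ≡⟨ length-blocks-of D m ⟩
      t                                ≡⟨ +-identityʳ t ⟨
      t + 0                            ≡⟨ cong₂ _+_ (m*n/n≡m t 12) (m<n⇒m/n≡0 c<12) ⟨
      t * 12 / 12 + c / 12             ≡⟨ +-distrib-/-∣ˡ c (n∣m*n t) ⟨
      (t * 12 + c) / 12                ≡⟨ cong (λ n → (n ∸ 1) / 12) (lemma (proj₁ (size D)) (proj₂ (size D)) c m) ⟩
      (v ∸ 1) / 12                     ∎
  }
  where
  open ≡-Reasoning
  𝓑 = blocks-of D m
  t = size D at m
  lemma : ∀ K T c m → suc ((K * m + T) * 12 + c) ≡ 12 * K * m + (12 * T + suc c)
  lemma = solve-∀

-- Reduction of the number of blocks to finitely many entries

Excluded : ℕ → Set
Excluded v = v ≡ 16 ⊎ v ≡ 25 ⊎ v ≡ 28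

at-index : List Design → ℕ → Design
at-index []       _       = []
at-index (D ∷ _)  zero    = D
at-index (_ ∷ Ds) (suc t) = at-index Ds t

-- Entries below 21 are used with m = 0 only.  Entries 21 to 26 have rate 6 and
-- give the designs with 6 m + t blocks for all m.
Entry : ℕ → List Design → ℕ → Set
Entry c designs t = (t < 21 × Excluded (12 * t + c)) ⊎
  (Works c (at-index designs t) × proj₂ (size (at-index designs t)) ≡ t ×
    (t < 21 ⊎ proj₁ (size (at-index designs t)) ≡ 6))

entry? : ∀ c designs t → Dec (Entry c designs t)
entry? c designs t = (t <? 21 ×-dec (_ ≟ 16 ⊎-dec _ ≟ 25 ⊎-dec _ ≟ 28)) ⊎-dec
  (works? c (at-index designs t) ×-dec _ ≟ t ×-dec (t <? 21 ⊎-dec _ ≟ 6))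

-- The entries 21 to 26 represent all residues modulo 6, so every larger t is reached from one of
-- them by adding 6 m; smaller t are their own entries.
reduce : ∀ t → ∃[ n ] ∃[ m ] (n < 27 × t ≡ 6 * m + n × (m ≡ 0 ⊎ 21 ≤ n))
reduce t with t <? 27
... | yes t<27 = t , 0 , t<27 , refl , inj₁ refl
... | no  t≮27 = 21 + s % 6 , s / 6 , +-monoʳ-< 21 (m%n<n s 6) , eq , inj₂ (m≤m+n 21 _)
  where
  s = t ∸ 21
  lemma : ∀ r q → 21 + (r + q * 6) ≡ 6 * q + (21 + r)
  lemma = solve-∀
  eq : t ≡ 6 * (s / 6) + (21 + s % 6)
  eq = begin
    t                           ≡⟨ m+[n∸m]≡n (≤-trans (m≤m+n 21 6) (≮⇒≥ t≮27)) ⟨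
    21 + s                      ≡⟨ cong (λ n → 21 + n) (m≡m%n+[m/n]*n s 6) ⟩
    21 + (s % 6 + s / 6 * 6)    ≡⟨ lemma (s % 6) (s / 6) ⟩
    6 * (s / 6) + (21 + s % 6)  ∎
    where open ≡-Reasoning

table⇒optimal : ∀ c → c < 12 → ∀ designs → (∀ {t} → t < 27 → Entry (suc c) designs t) →
                ∀ t v .{{_ : NonZero v}} → v ≡ 12 * t + suc c → v ≢ 16 → v ≢ 25 → v ≢ 28 →
                ∃[ C ] IsOptimalOOC v 4 C
table⇒optimal c c<12 designs table t v v≡ ≢16 ≢25 ≢28 with reduce t
... | n , m , n<27 , t≡ , regular with table n<27
...   | inj₁ (n<21 , excluded) = contradiction (v-excluded regular) λ
        { (inj₁ v≡16) → ≢16 v≡16 ; (inj₂ (inj₁ v≡25)) → ≢25 v≡25 ; (inj₂ (inj₂ v≡28)) → ≢28 v≡28 }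
  where
  v-excluded : m ≡ 0 ⊎ 21 ≤ n → Excluded v
  v-excluded (inj₁ refl) = subst Excluded (sym (trans v≡ (cong (λ t → 12 * t + suc c) t≡))) excluded
  v-excluded (inj₂ 21≤n) = contradiction n<21 (≤⇒≯ 21≤n)
...   | inj₂ (works , n≡ , large) = optimal c c<12 (at-index designs n) works m v
          (trans v≡ (trans (cong (λ t → 12 * t + suc c) (trans t≡ (split regular large)))
            (lemma K (proj₂ (size (at-index designs n))) c m)))
  where
  K = proj₁ (size (at-index designs n))
  -- Either m = 0 and the term in m vanishes on both sides, or n is at least 21 and the entry gains
  -- 6 blocks with each step of m.
  split : m ≡ 0 ⊎ 21 ≤ n → n < 21 ⊎ K ≡ 6 → 6 * m + n ≡ K * m + proj₂ (size (at-index designs n))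
  split (inj₁ refl) _           = sym (cong₂ _+_ (*-zeroʳ K) n≡)
  split (inj₂ 21≤n) (inj₁ n<21) = contradiction n<21 (≤⇒≯ 21≤n)
  split (inj₂ _)    (inj₂ K≡6)  = cong₂ (λ K T → K * m + T) (sym K≡6) (sym n≡)
  lemma : ∀ K T c m → 12 * (K * m + T) + suc c ≡ 12 * K * m + (12 * T + suc c)
  lemma = solve-∀

-- The computed designs

fixed : ℕ → ℕ → ℕ → Row
fixed x y z = row (0 , 0) (form 0 x 0 0) (form 0 y 0 0) (form 0 z 0 0)

single : (a b a′ b′ a″ b″ : ℕ) → Row
single a b a′ b′ a″ b″ = row (0 , 0) (form a b 0 0) (form a′ b′ 0 0) (form a″ b″ 0 0)

-- The `[]` at index 0 is the design without blocks for v = 1; the one at index 2 holds the place of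
-- the excluded v = 25.
designs₁ : List Design
designs₁ =
  [] ∷
  (fixed 1 2 6 ∷ []) ∷
  [] ∷
  (fixed 1 2 21 ∷ fixed 4 5 6 ∷ fixed 7 10 8 ∷ []) ∷
  (fixed 1 2 11 ∷ fixed 4 5 23 ∷ fixed 6 10 15 ∷ fixed 7 12 8 ∷ []) ∷
  (fixed 1 5 9 ∷ fixed 2 17 8 ∷ fixed 3 4 33 ∷ fixed 10 13 22 ∷ fixed 11 18 12 ∷ []) ∷
  (fixed 1 4 12 ∷ fixed 2 9 24 ∷ fixed 3 18 13 ∷ fixed 6 23 14 ∷ fixed 7 15 10 ∷ fixed 8 19 26 ∷ []) ∷
  (fixed 1 8 39 ∷ fixed 2 13 3 ∷ fixed 4 25 24 ∷ fixed 5 26 19 ∷ fixed 6 17 11 ∷ fixed 7 14 44 ∷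
   fixed 10 12 30 ∷ []) ∷
  (fixed 1 8 15 ∷ fixed 2 45 4 ∷ fixed 3 25 5 ∷ fixed 6 11 10 ∷ fixed 7 34 20 ∷ fixed 12 14 39 ∷
   fixed 13 18 37 ∷ fixed 16 19 40 ∷ []) ∷
  (fixed 1 3 86 ∷ fixed 2 31 16 ∷ fixed 5 9 45 ∷ fixed 6 15 56 ∷ fixed 7 22 44 ∷ fixed 8 27 34 ∷
   fixed 10 18 39 ∷ fixed 11 13 17 ∷ fixed 12 25 26 ∷ []) ∷
  (fixed 1 22 14 ∷ fixed 2 28 43 ∷ fixed 3 29 31 ∷ fixed 4 20 25 ∷ fixed 5 13 56 ∷ fixed 6 10 54 ∷
   fixed 7 33 46 ∷ fixed 8 11 15 ∷ fixed 9 12 41 ∷ fixed 17 27 39 ∷ []) ∷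
  (fixed 1 6 5 ∷ fixed 2 49 15 ∷ fixed 3 27 26 ∷ fixed 4 40 39 ∷ fixed 8 16 21 ∷ fixed 9 19 59 ∷
   fixed 10 31 32 ∷ fixed 13 22 36 ∷ fixed 14 29 57 ∷ fixed 17 25 23 ∷ fixed 18 20 61 ∷ []) ∷
  (fixed 1 26 29 ∷ fixed 2 7 53 ∷ fixed 3 31 44 ∷ fixed 4 13 25 ∷ fixed 5 18 50 ∷ fixed 6 35 58 ∷
   fixed 8 37 43 ∷ fixed 10 12 54 ∷ fixed 14 16 33 ∷ fixed 15 24 47 ∷ fixed 20 28 36 ∷
   fixed 21 19 94 ∷ []) ∷
  (fixed 1 35 26 ∷ fixed 2 3 75 ∷ fixed 4 10 45 ∷ fixed 7 25 24 ∷ fixed 8 50 42 ∷ fixed 9 28 48 ∷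
   fixed 11 43 40 ∷ fixed 13 17 93 ∷ fixed 15 6 124 ∷ fixed 16 22 68 ∷ fixed 18 23 46 ∷
   fixed 19 52 66 ∷ fixed 29 31 53 ∷ []) ∷
  (fixed 1 10 36 ∷ fixed 2 20 115 ∷ fixed 3 68 18 ∷ fixed 5 69 70 ∷ fixed 7 38 40 ∷
   fixed 8 15 111 ∷ fixed 12 16 120 ∷ fixed 13 26 64 ∷ fixed 14 37 56 ∷ fixed 17 50 27 ∷
   fixed 19 41 65 ∷ fixed 24 31 42 ∷ fixed 48 4 108 ∷ fixed 53 6 81 ∷ []) ∷
  (fixed 1 78 96 ∷ fixed 2 47 21 ∷ fixed 3 13 88 ∷ fixed 4 35 20 ∷ fixed 8 37 29 ∷ fixed 9 44 14 ∷
   fixed 10 61 28 ∷ fixed 11 15 112 ∷ fixed 12 22 97 ∷ fixed 17 31 87 ∷ fixed 18 106 24 ∷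
   fixed 19 23 98 ∷ fixed 25 5 95 ∷ fixed 27 38 52 ∷ fixed 32 40 36 ∷ []) ∷
  (fixed 3 67 25 ∷ fixed 4 46 136 ∷ fixed 5 16 112 ∷ fixed 6 17 118 ∷ fixed 8 32 22 ∷
   fixed 9 47 49 ∷ fixed 10 34 104 ∷ fixed 12 36 74 ∷ fixed 13 64 86 ∷ fixed 20 31 69 ∷
   fixed 24 63 28 ∷ fixed 26 1 14 ∷ fixed 29 39 72 ∷ fixed 33 2 59 ∷ fixed 37 42 38 ∷
   fixed 66 19 90 ∷ []) ∷
  (fixed 1 49 42 ∷ fixed 3 54 63 ∷ fixed 4 33 39 ∷ fixed 7 13 127 ∷ fixed 8 35 32 ∷ fixed 9 38 23 ∷
   fixed 10 41 55 ∷ fixed 12 5 69 ∷ fixed 14 132 11 ∷ fixed 16 24 121 ∷ fixed 18 27 66 ∷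
   fixed 22 34 46 ∷ fixed 26 64 15 ∷ fixed 28 53 29 ∷ fixed 30 71 98 ∷ fixed 68 19 2 ∷
   fixed 97 25 52 ∷ []) ∷
  (fixed 1 22 145 ∷ fixed 3 16 79 ∷ fixed 4 52 91 ∷ fixed 5 27 41 ∷ fixed 6 9 141 ∷ fixed 7 28 90 ∷
   fixed 10 21 17 ∷ fixed 11 86 20 ∷ fixed 13 24 64 ∷ fixed 14 29 40 ∷ fixed 18 85 75 ∷
   fixed 26 34 44 ∷ fixed 33 47 55 ∷ fixed 46 8 58 ∷ fixed 53 77 51 ∷ fixed 59 62 71 ∷
   fixed 63 45 107 ∷ fixed 81 94 30 ∷ []) ∷
  (fixed 1 21 57 ∷ fixed 2 74 65 ∷ fixed 3 69 58 ∷ fixed 4 60 34 ∷ fixed 5 32 75 ∷ fixed 8 41 129 ∷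
   fixed 10 18 91 ∷ fixed 11 20 114 ∷ fixed 14 33 111 ∷ fixed 15 24 89 ∷ fixed 16 40 30 ∷
   fixed 25 48 19 ∷ fixed 26 77 44 ∷ fixed 27 54 12 ∷ fixed 29 6 177 ∷ fixed 42 13 50 ∷
   fixed 45 23 123 ∷ fixed 61 36 7 ∷ fixed 87 9 53 ∷ []) ∷
  (fixed 1 6 31 ∷ fixed 2 120 106 ∷ fixed 3 147 23 ∷ fixed 4 28 139 ∷ fixed 5 87 54 ∷
   fixed 8 22 129 ∷ fixed 9 51 48 ∷ fixed 10 14 65 ∷ fixed 11 29 84 ∷ fixed 16 50 35 ∷
   fixed 19 20 76 ∷ fixed 21 56 67 ∷ fixed 26 62 81 ∷ fixed 33 125 36 ∷ fixed 34 41 107 ∷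
   fixed 44 25 17 ∷ fixed 46 57 111 ∷ fixed 49 137 43 ∷ fixed 52 53 78 ∷ fixed 64 114 18 ∷ []) ∷
  -- Six families come first, then the single blocks that fill the gaps. In terms of n = m + 4 the
  -- first row consists of {0, 4 n + 2 + 3 i, 14 n - 6 + i, 41 n - 18 + 2 i} with i from 0 to n - 4.
  -- Entries 23 and 24 use a second choice of the six families.
  (row (1 , 0) (form 4 18 3 0) (form 8 32 0 2) (form 27 96 1 0) ∷
   row (1 , 0) (form 3 12 1 0) (form 55 195 1 0) (form 7 27 1 0) ∷
   row (1 , 1) (form 19 69 1 0) (form 18 63 1 0) (form 28 101 1 0) ∷
   row (1 , 0) (form 0 7 3 0) (form 24 86 0 2) (form 15 54 1 0) ∷
   row (1 , 0) (form 11 40 1 0) (form 10 37 1 0) (form 48 171 1 0) ∷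
   row (1 , 1) (form 20 72 1 0) (form 17 61 1 0) (form 32 114 1 0) ∷ single 7 21 19 67 46 161 ∷
   single 15 51 26 90 31 110 ∷ single 7 22 21 75 8 30 ∷ single 4 13 10 34 48 170 ∷
   single 3 9 7 24 55 194 ∷ single 12 43 14 48 27 94 ∷ single 12 41 12 44 17 60 ∷
   single 3 8 16 57 33 117 ∷ single 4 16 7 23 37 130 ∷ single 3 10 41 144 28 98 ∷
   single 8 29 21 74 16 55 ∷ single 4 15 19 66 16 56 ∷ single 4 14 8 28 49 173 ∷ []) ∷
  (row (1 , 0) (form 4 20 3 0) (form 8 33 0 2) (form 27 102 1 0) ∷
   row (1 , 1) (form 3 12 1 0) (form 55 202 1 0) (form 7 27 1 0) ∷
   row (1 , 1) (form 19 72 1 0) (form 18 66 1 0) (form 28 105 1 0) ∷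
   row (1 , 1) (form 0 2 3 0) (form 24 91 0 2) (form 15 57 1 0) ∷
   row (1 , 0) (form 11 42 1 0) (form 10 38 1 0) (form 48 179 1 0) ∷
   row (1 , 0) (form 20 76 1 0) (form 17 65 1 0) (form 32 117 1 0) ∷ single 27 97 12 45 33 119 ∷
   single 33 118 4 18 35 126 ∷ single 3 8 21 81 7 23 ∷ single 7 25 8 31 21 78 ∷
   single 12 46 4 14 56 204 ∷ single 8 32 12 43 11 39 ∷ single 4 17 19 68 14 52 ∷
   single 3 9 7 26 4 15 ∷ single 8 30 11 40 10 37 ∷ single 4 16 15 55 8 29 ∷
   single 3 11 21 79 24 87 ∷ single 12 44 15 54 28 103 ∷ single 3 10 16 59 20 74 ∷ []) ∷
  (row (1 , 0) (form 6 24 1 0) (form 11 47 2 0) (form 23 90 0 1) ∷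
   row (1 , 1) (form 3 16 2 0) (form 9 35 0 1) (form 39 153 2 0) ∷
   row (1 , 1) (form 0 3 3 0) (form 3 15 0 2) (form 20 78 1 0) ∷
   row (1 , 1) (form 14 55 1 0) (form 27 105 1 0) (form 28 110 1 0) ∷
   row (1 , 1) (form 7 28 1 0) (form 8 33 1 0) (form 37 143 1 0) ∷
   row (1 , 0) (form 10 41 1 0) (form 21 82 1 0) (form 38 149 1 0) ∷ single 10 37 11 43 22 83 ∷
   single 3 8 17 66 35 136 ∷ single 3 9 3 14 14 54 ∷ single 7 25 8 32 21 81 ∷
   single 5 19 10 40 33 125 ∷ single 8 30 23 89 8 31 ∷ single 11 44 27 102 34 130 ∷
   single 3 11 25 97 13 48 ∷ single 6 22 7 27 15 58 ∷ single 3 10 47 181 22 84 ∷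
   single 11 42 13 50 28 109 ∷ single 3 13 10 38 35 135 ∷ single 7 26 10 39 17 64 ∷ []) ∷
  (row (1 , 1) (form 6 27 1 0) (form 11 46 2 0) (form 23 94 0 1) ∷
   row (1 , 1) (form 3 17 2 0) (form 9 37 0 1) (form 39 160 2 0) ∷
   row (1 , 1) (form 0 6 3 0) (form 3 14 0 2) (form 20 82 1 0) ∷
   row (1 , 2) (form 14 58 1 0) (form 27 107 1 0) (form 28 116 1 0) ∷
   row (1 , 0) (form 7 30 1 0) (form 8 35 1 0) (form 37 149 1 0) ∷
   row (1 , 1) (form 10 42 1 0) (form 21 86 1 0) (form 38 154 1 0) ∷ single 3 12 14 57 55 217 ∷
   single 8 33 20 77 13 54 ∷ single 3 11 6 25 38 150 ∷ single 5 18 15 63 13 52 ∷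
   single 6 26 17 67 24 96 ∷ single 3 10 7 29 10 41 ∷ single 25 101 13 50 34 137 ∷
   single 5 21 6 24 41 166 ∷ single 5 20 17 68 22 89 ∷ single 3 13 8 31 51 205 ∷
   single 8 32 20 79 8 34 ∷ single 13 51 21 85 15 61 ∷ []) ∷
  (row (1 , 2) (form 4 19 3 0) (form 8 36 0 2) (form 27 115 1 0) ∷
   row (1 , 1) (form 3 15 1 0) (form 55 232 1 0) (form 7 30 1 0) ∷
   row (1 , 1) (form 19 81 1 0) (form 18 75 1 0) (form 28 119 1 0) ∷
   row (1 , 1) (form 0 4 3 0) (form 24 104 0 2) (form 15 65 1 0) ∷
   row (1 , 1) (form 11 47 1 0) (form 10 44 1 0) (form 48 202 1 0) ∷
   row (1 , 0) (form 20 88 1 0) (form 17 73 1 0) (form 32 134 1 0) ∷ single 33 137 4 20 35 142 ∷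
   single 3 9 4 18 45 187 ∷ single 14 56 19 79 39 165 ∷ single 7 28 12 49 21 92 ∷
   single 3 10 21 90 48 198 ∷ single 3 14 8 32 44 183 ∷ single 8 34 18 74 15 64 ∷
   single 3 12 12 50 8 35 ∷ single 3 11 16 67 29 121 ∷ single 4 17 15 63 17 70 ∷
   single 7 29 10 42 10 41 ∷ single 10 43 14 58 12 51 ∷ single 8 33 21 89 20 84 ∷ []) ∷
  (row (1 , 2) (form 4 21 3 0) (form 8 37 0 2) (form 27 119 1 0) ∷
   row (1 , 1) (form 3 15 1 0) (form 55 240 1 0) (form 7 33 1 0) ∷
   row (1 , 1) (form 19 85 1 0) (form 18 79 1 0) (form 28 123 1 0) ∷
   row (1 , 1) (form 0 4 3 0) (form 24 108 0 2) (form 15 66 1 0) ∷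
   row (1 , 1) (form 11 48 1 0) (form 10 46 1 0) (form 48 210 1 0) ∷
   row (1 , 1) (form 20 89 1 0) (form 17 76 1 0) (form 32 140 1 0) ∷ single 10 42 21 92 12 50 ∷
   single 3 10 4 18 65 282 ∷ single 4 20 19 81 29 125 ∷ single 3 11 20 88 12 51 ∷
   single 7 32 14 61 10 43 ∷ single 7 29 7 30 12 54 ∷ single 16 70 8 35 48 207 ∷
   single 3 12 12 53 21 91 ∷ single 10 44 17 74 27 117 ∷ single 3 14 16 68 37 162 ∷
   single 4 17 4 19 27 116 ∷ single 23 98 10 45 39 168 ∷ single 12 52 14 60 29 126 ∷ []) ∷ []

-- The `[]` at index 0 serves v = 4; those at 1 and 2 hold the places of the excluded 16 and 28.
-- Among the entries from 21 on, only 24 uses the second choice of families.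
designs₄ : List Design
designs₄ =
  [] ∷
  [] ∷
  [] ∷
  (fixed 1 8 5 ∷ fixed 2 4 11 ∷ fixed 3 7 12 ∷ []) ∷
  (fixed 1 10 18 ∷ fixed 2 15 16 ∷ fixed 3 5 4 ∷ fixed 6 7 25 ∷ []) ∷
  (fixed 1 3 49 ∷ fixed 2 16 7 ∷ fixed 5 8 22 ∷ fixed 6 20 17 ∷ fixed 9 10 14 ∷ []) ∷
  (fixed 1 16 23 ∷ fixed 2 7 56 ∷ fixed 3 5 41 ∷ fixed 4 18 6 ∷ fixed 10 15 19 ∷ fixed 12 14 29 ∷
   []) ∷
  (fixed 1 12 9 ∷ fixed 2 34 5 ∷ fixed 3 17 28 ∷ fixed 4 15 10 ∷ fixed 6 8 56 ∷ fixed 7 23 27 ∷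
   fixed 11 26 16 ∷ []) ∷
  (fixed 1 10 67 ∷ fixed 2 13 41 ∷ fixed 3 16 55 ∷ fixed 4 35 18 ∷ fixed 5 12 8 ∷ fixed 6 28 14 ∷
   fixed 7 30 32 ∷ fixed 9 27 24 ∷ []) ∷
  (fixed 1 20 52 ∷ fixed 2 26 17 ∷ fixed 3 12 32 ∷ fixed 4 6 71 ∷ fixed 5 13 70 ∷ fixed 7 9 50 ∷
   fixed 8 30 19 ∷ fixed 11 22 54 ∷ fixed 14 34 27 ∷ []) ∷
  (fixed 1 2 13 ∷ fixed 4 42 30 ∷ fixed 5 51 10 ∷ fixed 6 34 35 ∷ fixed 7 12 81 ∷ fixed 8 36 21 ∷
   fixed 9 20 18 ∷ fixed 11 22 17 ∷ fixed 14 23 60 ∷ fixed 25 28 26 ∷ []) ∷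
  (fixed 1 41 16 ∷ fixed 2 18 33 ∷ fixed 3 22 24 ∷ fixed 4 17 6 ∷ fixed 5 14 88 ∷ fixed 7 32 13 ∷
   fixed 8 28 65 ∷ fixed 9 47 26 ∷ fixed 10 50 12 ∷ fixed 11 44 15 ∷ fixed 30 31 38 ∷ []) ∷
  (fixed 1 12 75 ∷ fixed 2 30 64 ∷ fixed 3 35 27 ∷ fixed 4 44 7 ∷ fixed 5 11 47 ∷ fixed 6 15 18 ∷
   fixed 8 49 20 ∷ fixed 9 22 81 ∷ fixed 10 40 26 ∷ fixed 17 24 29 ∷ fixed 23 14 92 ∷
   fixed 25 34 46 ∷ []) ∷
  (fixed 1 21 4 ∷ fixed 2 50 10 ∷ fixed 3 16 70 ∷ fixed 5 51 28 ∷ fixed 6 18 94 ∷ fixed 7 39 53 ∷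
   fixed 8 27 30 ∷ fixed 9 36 33 ∷ fixed 11 20 97 ∷ fixed 13 34 38 ∷ fixed 14 44 15 ∷
   fixed 23 83 37 ∷ fixed 29 12 55 ∷ []) ∷
  (fixed 1 26 31 ∷ fixed 2 10 7 ∷ fixed 3 25 62 ∷ fixed 4 36 9 ∷ fixed 8 14 24 ∷ fixed 11 33 89 ∷
   fixed 13 60 20 ∷ fixed 15 55 21 ∷ fixed 16 37 68 ∷ fixed 18 47 84 ∷ fixed 29 30 78 ∷
   fixed 32 43 34 ∷ fixed 56 5 69 ∷ fixed 66 52 48 ∷ []) ∷
  (fixed 1 61 41 ∷ fixed 2 35 52 ∷ fixed 3 27 43 ∷ fixed 4 72 22 ∷ fixed 6 34 11 ∷ fixed 7 59 113 ∷
   fixed 8 23 105 ∷ fixed 9 19 110 ∷ fixed 13 64 32 ∷ fixed 14 15 24 ∷ fixed 16 49 20 ∷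
   fixed 17 21 121 ∷ fixed 26 58 33 ∷ fixed 47 36 44 ∷ fixed 50 18 106 ∷ []) ∷
  (fixed 1 17 63 ∷ fixed 2 38 19 ∷ fixed 3 69 37 ∷ fixed 4 48 51 ∷ fixed 5 11 9 ∷ fixed 6 28 61 ∷
   fixed 7 26 121 ∷ fixed 10 13 54 ∷ fixed 12 41 85 ∷ fixed 14 36 86 ∷ fixed 15 79 55 ∷
   fixed 21 22 82 ∷ fixed 27 46 45 ∷ fixed 29 39 44 ∷ fixed 35 30 100 ∷ fixed 64 24 32 ∷ []) ∷
  (fixed 1 41 99 ∷ fixed 3 32 57 ∷ fixed 4 15 79 ∷ fixed 5 25 103 ∷ fixed 6 47 83 ∷
   fixed 7 20 100 ∷ fixed 10 49 36 ∷ fixed 13 26 138 ∷ fixed 14 63 24 ∷ fixed 16 22 23 ∷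
   fixed 17 43 11 ∷ fixed 18 28 69 ∷ fixed 33 51 66 ∷ fixed 55 132 12 ∷ fixed 56 40 50 ∷
   fixed 65 8 29 ∷ fixed 74 52 34 ∷ []) ∷
  (fixed 1 106 2 ∷ fixed 3 18 81 ∷ fixed 4 37 103 ∷ fixed 5 19 169 ∷ fixed 7 42 26 ∷
   fixed 8 45 12 ∷ fixed 10 20 47 ∷ fixed 11 52 95 ∷ fixed 13 48 101 ∷ fixed 15 28 44 ∷
   fixed 17 38 36 ∷ fixed 22 60 33 ∷ fixed 25 39 59 ∷ fixed 34 96 40 ∷ fixed 35 31 100 ∷
   fixed 56 23 6 ∷ fixed 69 9 128 ∷ fixed 88 46 70 ∷ []) ∷
  (fixed 1 145 34 ∷ fixed 3 42 77 ∷ fixed 4 56 46 ∷ fixed 5 26 143 ∷ fixed 6 51 40 ∷ fixed 7 2 16 ∷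
   fixed 8 70 83 ∷ fixed 12 50 74 ∷ fixed 13 24 94 ∷ fixed 14 47 19 ∷ fixed 15 17 151 ∷
   fixed 22 11 10 ∷ fixed 23 82 29 ∷ fixed 28 39 117 ∷ fixed 30 55 54 ∷ fixed 38 69 90 ∷
   fixed 41 59 44 ∷ fixed 72 27 68 ∷ fixed 92 36 84 ∷ []) ∷
  (fixed 1 26 103 ∷ fixed 2 59 12 ∷ fixed 3 39 161 ∷ fixed 4 58 85 ∷ fixed 5 31 156 ∷
   fixed 7 13 113 ∷ fixed 8 86 135 ∷ fixed 9 19 51 ∷ fixed 10 22 206 ∷ fixed 11 45 123 ∷
   fixed 14 50 75 ∷ fixed 21 47 128 ∷ fixed 25 74 63 ∷ fixed 30 37 87 ∷ fixed 33 60 24 ∷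
   fixed 35 77 89 ∷ fixed 40 104 34 ∷ fixed 91 17 55 ∷ fixed 92 18 80 ∷ fixed 96 53 49 ∷ []) ∷
  (row (1 , 0) (form 4 21 3 0) (form 8 31 0 2) (form 27 99 1 0) ∷
   row (1 , 1) (form 3 11 1 0) (form 55 197 1 0) (form 7 25 1 0) ∷
   row (1 , 0) (form 19 70 1 0) (form 18 66 1 0) (form 28 101 1 0) ∷
   row (1 , 1) (form 0 4 3 0) (form 24 88 0 2) (form 15 54 1 0) ∷
   row (1 , 0) (form 11 41 1 0) (form 10 36 1 0) (form 48 173 1 0) ∷
   row (1 , 0) (form 20 73 1 0) (form 17 62 1 0) (form 32 116 1 0) ∷ single 4 15 60 211 8 27 ∷
   single 21 74 10 33 41 147 ∷ single 4 17 23 79 12 43 ∷ single 3 8 65 234 4 13 ∷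
   single 10 35 16 56 19 67 ∷ single 4 16 8 28 49 175 ∷ single 14 51 19 68 16 57 ∷
   single 3 10 21 75 24 84 ∷ single 7 24 19 69 14 49 ∷ single 11 39 18 65 14 50 ∷
   single 11 38 20 72 17 60 ∷ single 8 29 18 63 18 64 ∷ single 11 40 12 42 29 103 ∷ []) ∷
  (row (1 , 0) (form 4 17 3 0) (form 8 35 0 2) (form 27 101 1 0) ∷
   row (1 , 1) (form 3 12 1 0) (form 55 205 1 0) (form 7 27 1 0) ∷
   row (1 , 1) (form 19 71 1 0) (form 18 69 1 0) (form 28 106 1 0) ∷
   row (1 , 0) (form 0 5 3 0) (form 24 94 0 2) (form 15 57 1 0) ∷
   row (1 , 1) (form 11 41 1 0) (form 10 37 1 0) (form 48 181 1 0) ∷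
   row (1 , 0) (form 20 77 1 0) (form 17 66 1 0) (form 32 121 1 0) ∷ single 7 20 57 215 8 30 ∷
   single 20 73 23 82 29 111 ∷ single 3 7 12 47 37 138 ∷ single 4 14 4 18 35 127 ∷
   single 3 8 8 31 16 61 ∷ single 26 97 18 68 28 102 ∷ single 11 40 15 55 17 65 ∷
   single 3 11 15 56 26 96 ∷ single 4 15 17 64 16 58 ∷ single 3 10 4 16 24 88 ∷
   single 12 43 12 46 12 44 ∷ single 8 29 12 45 23 84 ∷ single 7 25 16 60 16 59 ∷ []) ∷
  (row (1 , 0) (form 4 20 3 0) (form 8 36 0 2) (form 27 107 1 0) ∷
   row (1 , 0) (form 3 13 1 0) (form 55 216 1 0) (form 7 27 1 0) ∷
   row (1 , 2) (form 19 75 1 0) (form 18 71 1 0) (form 28 109 1 0) ∷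
   row (1 , 0) (form 0 5 3 0) (form 24 99 0 2) (form 15 60 1 0) ∷
   row (1 , 1) (form 11 45 1 0) (form 10 39 1 0) (form 48 189 1 0) ∷
   row (1 , 1) (form 20 78 1 0) (form 17 67 1 0) (form 32 126 1 0) ∷ single 4 14 4 21 7 23 ∷
   single 3 8 12 49 12 48 ∷ single 8 28 8 33 56 218 ∷ single 8 30 23 88 8 31 ∷
   single 32 122 4 16 36 139 ∷ single 3 12 18 69 8 34 ∷ single 11 41 37 144 24 93 ∷
   single 4 15 19 74 21 83 ∷ single 7 26 14 54 27 106 ∷ single 10 38 16 63 17 65 ∷
   single 3 10 8 32 40 156 ∷ single 4 17 14 53 15 59 ∷ single 3 11 14 55 12 47 ∷ []) ∷
  (row (1 , 1) (form 6 26 1 0) (form 11 49 2 0) (form 23 94 0 1) ∷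
   row (1 , 1) (form 3 16 2 0) (form 9 36 0 1) (form 39 162 2 0) ∷
   row (1 , 1) (form 0 3 3 0) (form 3 15 0 2) (form 20 83 1 0) ∷
   row (1 , 1) (form 14 60 1 0) (form 27 111 1 0) (form 28 116 1 0) ∷
   row (1 , 1) (form 7 30 1 0) (form 8 34 1 0) (form 37 152 1 0) ∷
   row (1 , 0) (form 10 41 1 0) (form 21 88 1 0) (form 38 156 1 0) ∷ single 3 8 55 225 14 58 ∷
   single 11 43 20 80 41 165 ∷ single 3 10 7 28 45 182 ∷ single 13 50 20 81 17 70 ∷
   single 13 52 14 55 21 87 ∷ single 6 22 14 57 11 45 ∷ single 3 11 3 14 5 19 ∷
   single 11 42 17 71 22 89 ∷ single 10 40 14 56 15 62 ∷ single 6 24 25 101 8 32 ∷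
   single 3 12 28 114 6 23 ∷ single 10 39 11 46 34 138 ∷ single 7 29 17 68 27 109 ∷ []) ∷
  (row (1 , 1) (form 4 22 3 0) (form 8 36 0 2) (form 27 116 1 0) ∷
   row (1 , 1) (form 3 14 1 0) (form 55 233 1 0) (form 7 30 1 0) ∷
   row (1 , 1) (form 19 82 1 0) (form 18 76 1 0) (form 28 120 1 0) ∷
   row (1 , 1) (form 0 3 3 0) (form 24 105 0 2) (form 15 65 1 0) ∷
   row (1 , 1) (form 11 47 1 0) (form 10 44 1 0) (form 48 206 1 0) ∷
   row (1 , 1) (form 20 86 1 0) (form 17 73 1 0) (form 32 137 1 0) ∷ single 4 16 4 21 8 32 ∷
   single 3 10 4 19 54 229 ∷ single 4 18 44 185 24 99 ∷ single 3 9 24 103 21 88 ∷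
   single 10 40 21 90 12 49 ∷ single 3 11 16 67 33 142 ∷ single 7 28 8 35 24 100 ∷
   single 3 12 12 50 28 118 ∷ single 12 51 14 58 31 131 ∷ single 3 13 17 72 4 17 ∷
   single 14 59 19 81 16 68 ∷ single 10 42 43 182 19 79 ∷ single 8 33 27 114 8 34 ∷ []) ∷
  (row (1 , 1) (form 4 22 3 0) (form 8 38 0 2) (form 27 120 1 0) ∷
   row (1 , 2) (form 3 14 1 0) (form 55 242 1 0) (form 7 33 1 0) ∷
   row (1 , 1) (form 19 85 1 0) (form 18 81 1 0) (form 28 124 1 0) ∷
   row (1 , 1) (form 0 4 3 0) (form 24 110 0 2) (form 15 67 1 0) ∷
   row (1 , 1) (form 11 50 1 0) (form 10 45 1 0) (form 48 212 1 0) ∷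
   row (1 , 1) (form 20 90 1 0) (form 17 77 1 0) (form 32 141 1 0) ∷ single 3 10 29 129 11 47 ∷
   single 4 17 20 88 48 208 ∷ single 7 28 16 71 49 215 ∷ single 4 18 33 146 35 151 ∷
   single 3 11 12 55 33 143 ∷ single 3 12 8 36 49 216 ∷ single 10 42 21 93 20 87 ∷
   single 7 29 7 32 46 201 ∷ single 3 13 17 76 26 114 ∷ single 7 31 11 49 37 161 ∷
   single 12 53 16 69 23 102 ∷ single 10 43 19 84 16 70 ∷ single 10 44 18 79 15 65 ∷ []) ∷ []

-- Verification of the entries and the two residue classes

table₁ : ∀ {t} → t < 27 → Entry 1 designs₁ t
table₁ = toWitness {a? = allUpTo? (entry? 1 designs₁) 27} _

table₄ : ∀ {t} → t < 27 → Entry 4 designs₄ t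
table₄ = toWitness {a? = allUpTo? (entry? 4 designs₄) 27} _

theorem1p3 : (v : ℕ) .{{_ : NonZero v}} → v % 12 ≡ 1 ⊎ v % 12 ≡ 4 →
    v ≢ 16 → v ≢ 25 → v ≢ 28 →
    ∃[ C ] IsOptimalOOC v 4 C
theorem1p3 v residue = dispatch residue
  where
  v≡ : ∀ {r} → v % 12 ≡ r → v ≡ 12 * (v / 12) + r
  v≡ {r} eq = begin
    v                    ≡⟨ m≡m%n+[m/n]*n v 12 ⟩
    v % 12 + v / 12 * 12 ≡⟨ cong₂ _+_ eq (*-comm (v / 12) 12) ⟩
    r + 12 * (v / 12)    ≡⟨ +-comm r _ ⟩
    12 * (v / 12) + r    ∎
    where open ≡-Reasoning
  dispatch : _ → _
  dispatch (inj₁ v≡1) = table⇒optimal 0 (s≤s z≤n) designs₁ table₁ (v / 12) v (v≡ v≡1)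
  dispatch (inj₂ v≡4) = table⇒optimal 3 (s≤s (s≤s (s≤s (s≤s z≤n)))) designs₄ table₄ (v / 12) v (v≡ v≡4)
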